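{- For every integer $k\ge 1$ and all positive integers $e,n$ with $e\le \frac{n^2}{4}$ we have $$ex_{bip}(n,e,S_k)=N(S_k,B^e_n).$$
   Context: $S_k$ denotes the star with $k$ leaves. For graphs $H,G$, $N(H,G)$ is the number of subgraphs of $G$ isomorphic to $H$. $ex_{bip}(n,e,H)=\max\{N(H,B): B \text{ bipartite}, |V(B)|=n, |E(B)|=e\}$. For positive integers $n,e$ with $e\le n^2/4$, let $t$ be the smallest positive integer $i$ with $i(n-i)\ge e$ (so $1\le t\le n/2$); the quasi-complete bipartite graph $B^e_n$ is obtained from the complete bipartite graph $K_{t,n-t}$ by picking a vertex of degree $n-t$ and deleting $t(n-t)-e$ of its edges. -}

module Defs where

open import Data.Bool using (Bool; true; false; _∧_; _∨_; not; if_then_else_)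
open import Data.Bool.Properties using (∨-comm)
open import Data.Nat using (ℕ; zero; suc; _+_; _*_; _∸_; _≤_; _<ᵇ_; _≤ᵇ_; _≡ᵇ_)
open import Data.Fin using (Fin; toℕ)
open import Data.List using (List; []; _∷_; map; _++_; length; concatMap; allFin; filterᵇ)
open import Data.Bool.ListAction using (all; any)
open import Data.Product using (_×_; _,_; Σ)
open import Relation.Binary.PropositionalEquality using (_≡_; _≢_; refl)

record Graph (n : ℕ) : Set where
  field
    adj    : Fin n → Fin n → Bool
    sym    : ∀ i j → adj i j ≡ adj j i
    irrefl : ∀ i → adj i i ≡ false

open Graph public

allPairs : (n : ℕ) → List (Fin n × Fin n)
allPairs n = concatMap (λ i → map (λ j → (i , j)) (allFin n)) (allFin n)

edges : ∀ {n} → Graph n → List (Fin n × Fin n)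
edges {n} G = filterᵇ (λ p → (toℕ (Data.Product.proj₁ p) <ᵇ toℕ (Data.Product.proj₂ p))
                             ∧ adj G (Data.Product.proj₁ p) (Data.Product.proj₂ p))
                      (allPairs n)

numEdges : ∀ {n} → Graph n → ℕ
numEdges G = length (edges G)

IsBipartite : ∀ {n} → Graph n → Set
IsBipartite {n} G = Σ (Fin n → Bool) λ c → ∀ i j → adj G i j ≡ true → c i ≢ c j

combinations : {A : Set} → ℕ → List A → List (List A)
combinations zero    xs       = [] ∷ []
combinations (suc k) []       = []
combinations (suc k) (x ∷ xs) = map (x ∷_) (combinations k xs) ++ combinations (suc k) xs

incident : ∀ {n} → Fin n → Fin n × Fin n → Bool
incident v (a , b) = (toℕ a ≡ᵇ toℕ v) ∨ (toℕ b ≡ᵇ toℕ v)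

hasCommonVertex : ∀ {n} → List (Fin n × Fin n) → Bool
hasCommonVertex {n} F = any (λ v → all (incident v) F) (allFin n)

-- N(S_k, G): number of subgraphs of G isomorphic to the star S_k (k ≥ 1),
-- i.e. the number of k-element edge sets of G whose edges all share a vertex
-- (for k ≥ 1 such an edge set, with its endpoints, is exactly a copy of K_{1,k}).
numStars : ∀ {n} → ℕ → Graph n → ℕ
numStars k G = length (filterᵇ hasCommonVertex (combinations k (edges G)))

tParam : ℕ → ℕ → ℕ
tParam n e = go n 1
  where
  go : ℕ → ℕ → ℕ
  go zero    i = i
  go (suc f) i = if e ≤ᵇ i * (n ∸ i) then i else go f (suc i)

-- Vertices 0..t-1 form the part of size t, vertices t..n-1 the part of size n-t.
-- Vertex 0 (degree n-t in K_{t,n-t}) loses its edges to the last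
-- d = t(n-t) - e vertices n-d, ..., n-1.
quasiCross : ℕ → ℕ → ℕ → ℕ → Bool
quasiCross n e a b =
  let t = tParam n e
      d = t * (n ∸ t) ∸ e
  in (a <ᵇ t) ∧ (not (b <ᵇ t) ∧ (not (a ≡ᵇ 0) ∨ (b <ᵇ n ∸ d)))

private
  noLoop : ∀ y x → y ∧ (not y ∧ x) ≡ false
  noLoop true  x = refl
  noLoop false x = refl

  ∨-false : ∀ {x y} → x ≡ false → y ≡ false → (x ∨ y) ≡ false
  ∨-false refl refl = refl

quasiComplete : (n e : ℕ) → Graph n
quasiComplete n e = record
  { adj    = λ i j → quasiCross n e (toℕ i) (toℕ j) ∨ quasiCross n e (toℕ j) (toℕ i)
  ; sym    = λ i j → ∨-comm (quasiCross n e (toℕ i) (toℕ j)) (quasiCross n e (toℕ j) (toℕ i))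
  ; irrefl = λ i → ∨-false (lp (toℕ i)) (lp (toℕ i))
  }
  where
  lp : ∀ a → quasiCross n e a a ≡ false
  lp a = noLoop (a <ᵇ tParam n e) _

{-# OPTIONS --safe #-}
-- For k ≥ 2 the number of stars is Σ_v C(deg v, k), so fix a primitive G of a monotone convex g
-- (G = C(_, k), g = C(_, k-1)) and bound Σ_v G (deg v).  Write e = Q M + r with 1 ≤ r ≤ M and
-- n = M + Q + 1; the extremal graph has Q full rows of length M and one row of length r.
-- Induct on the number of vertices.  Let p be the minimum degree.  If p < r, delete a vertex of
-- degree p: the loss is at most G p + p g (A - 1), where A bounds the degrees of its neighbours,
-- and convexity shows that the extremal value drops by at least this much.  If p ≥ r, some
-- non-adjacent pair on opposite sides has degrees at least r > Q, and joining it gains at least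
-- g r + g Q, which is exactly the growth of the extremal value from e to e + 1 edges.
module Submission where

open import Defs hiding (sym)
open import Data.Bool using (Bool; true; false; not; _∧_; _∨_; T; if_then_else_)
open import Data.Bool.ListAction using (all; any)
import Data.Bool.Properties as Bool
open import Data.Empty using (⊥; ⊥-elim)
open import Data.Fin using (Fin; zero; suc; punchIn; toℕ)
open import Data.Fin.Properties using (any?; toℕ-injective) renaming (_≟_ to _≟ᶠ_)
open import Data.List
  using (List; []; _∷_; map; _++_; length; concat; concatMap; tabulate; allFin; filterᵇ; cartesianProduct)
import Data.List.Properties as List
open import Data.List.Relation.Unary.All as All using (All; []; _∷_)
import Data.List.Relation.Unary.All.Properties as All
open import Data.List.Relation.Unary.AllPairs using (AllPairs; []; _∷_)
open import Data.List.Relation.Unary.Unique.Propositional using (Unique)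
import Data.List.Relation.Unary.Unique.Propositional.Properties as Unique
open import Data.Nat
open import Data.Nat.Combinatorics using (_C_; k>n⇒nCk≡0; nCk+nC[k+1]≡[n+1]C[k+1])
open import Data.Nat.Properties
open import Data.Nat.Solver using (module +-*-Solver)
open import Data.Product using (_×_; _,_; ∃; proj₁; proj₂)
open import Data.Sum using (_⊎_; inj₁; inj₂)
open import Function using (_∘_; id)
open import Relation.Binary.Definitions using (tri<; tri≈; tri>)
open import Relation.Binary.PropositionalEquality
open import Relation.Nullary using (¬_; yes; no; ⌊_⌋; ¬?; contradiction; _×-dec_)

open import Algebra.Properties.Semiring.Sum +-*-semiring
open +-*-Solver using (solve; con; _:+_; _:*_; _:=_)

-- Inequalities for convex sequences

-- The condition p < r is what makes deletion legitimate: the remaining e - p edges exceed Q M, the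
-- capacity of parts of sizes M and Q, so on n - 1 vertices they still fit into no bipartition with
-- a part larger than M - 1. The relation n = M + Q + 1 is not stable under deletion: when the short
-- row overflows, Q grows by one while M and n drop by one, which leaves n = M + Q. The induction
-- therefore keeps Q and r free and carries only n ≤ 2 M and the exclusion of larger parts; if n ≤ M
-- + Q, the same edges are repacked with M - 1 in place of M, which does not raise the extremal
-- value. The choice A = M works for p ≤ Q. For p > Q it is too crude: only Q rows of the extremal
-- graph have length M, so p neighbours charged g (M - 1) each can cost more than the drop. There A
-- is the maximum degree. The neighbours of a vertex of degree A lie on one side and have degree at
-- least p, hence p A ≤ e, and this feeds a tangent-line estimate for g at A - 1.

≤-cancel : ∀ {x y l r} z → x + z ≡ l → l ≤ r → r ≡ y + z → x ≤ y
≤-cancel {x} {y} z refl l≤r refl = +-cancelʳ-≤ z x y l≤r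

record ConvexPrimitive (G g : ℕ → ℕ) : Set where
  field
    G-zero : G 0 ≡ 0
    G-suc  : ∀ x → G (suc x) ≡ G x + g x
    g-step : ∀ x → g x ≤ g (suc x)
    convex : ∀ x → g (suc x) + g (suc x) ≤ g x + g (2 + x)

-- Σ_v G (deg v) for the graph whose bipartite adjacency matrix has Q full rows of length M
-- and one further row of length r.
quasiSum : (G g : ℕ → ℕ) → ℕ → ℕ → ℕ → ℕ
quasiSum G g M Q r = Q * G M + M * G Q + r * g Q + G r

module Convexity {G g : ℕ → ℕ} (cp : ConvexPrimitive G g) where
  open ConvexPrimitive cp

  f : ℕ → ℕ → ℕ → ℕ
  f = quasiSum G g

  g-mono-+ : ∀ x k → g x ≤ g (k + x)
  g-mono-+ x zero    = ≤-refl
  g-mono-+ x (suc k) = ≤-trans (g-mono-+ x k) (g-step (k + x))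

  g-mono : ∀ {x y} → x ≤ y → g x ≤ g y
  g-mono {x} x≤y with m≤n⇒∃[o]m+o≡n x≤y
  ... | k , refl rewrite +-comm x k = g-mono-+ x k

  increment-mono-+ : ∀ x k → g (suc x) + g (k + x) ≤ g x + g (suc (k + x))
  increment-mono-+ x zero    = ≤-reflexive (+-comm (g (suc x)) (g x))
  increment-mono-+ x (suc k) = ≤-cancel (g (k + x) + g (suc (k + x)))
    (e₁ (g (suc x)) (g (suc (k + x))) (g (k + x)))
    (+-mono-≤ (increment-mono-+ x k) (convex (k + x)))
    (e₂ (g x) (g (suc (k + x))) (g (k + x)) (g (2 + (k + x))))
    where
    e₁ = solve 3 (λ a b c → a :+ b :+ (c :+ b) := a :+ c :+ (b :+ b)) refl
    e₂ = solve 4 (λ a b c d → a :+ b :+ (c :+ d) := a :+ d :+ (c :+ b)) refl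

  increment-mono : ∀ {x y} → x ≤ y → g (suc x) + g y ≤ g x + g (suc y)
  increment-mono {x} x≤y with m≤n⇒∃[o]m+o≡n x≤y
  ... | k , refl rewrite +-comm x k = increment-mono-+ x k

  g-spread-+ : ∀ a x y → g (a + x) + g (a + y) ≤ g a + g (a + (x + y))
  g-spread-+ a zero    y rewrite +-identityʳ a = ≤-refl
  g-spread-+ a (suc x) y rewrite +-suc a x | +-suc a (x + y) = ≤-cancel (g (a + (x + y)) + g (a + x))
    (e₁ (g (suc (a + x))) (g (a + y)) (g (a + (x + y))) (g (a + x)))
    (+-mono-≤ (increment-mono (+-monoʳ-≤ a (m≤m+n x y))) (g-spread-+ a x y))
    (e₂ (g (a + x)) (g (suc (a + (x + y)))) (g a) (g (a + (x + y))))
    where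
    e₁ = solve 4 (λ p q r s → p :+ q :+ (r :+ s) := p :+ r :+ (s :+ q)) refl
    e₂ = solve 4 (λ p q r s → p :+ q :+ (r :+ s) := r :+ q :+ (s :+ p)) refl

  -- For b + c = a + d this is convexity, with b and c between a and d; monotonicity of g absorbs a
  -- larger d.
  g-spread : ∀ {a b c d} → a ≤ b → a ≤ c → b + c ≤ a + d → g b + g c ≤ g a + g d
  g-spread {a} {d = d} a≤b a≤c bc≤ad with m≤n⇒∃[o]m+o≡n a≤b | m≤n⇒∃[o]m+o≡n a≤c
  ... | x , refl | y , refl = ≤-trans (g-spread-+ a x y) (+-monoʳ-≤ (g a) (g-mono
      (+-cancelˡ-≤ a _ _ (≤-trans (≤-reflexive (e a x y)) bc≤ad))))
    where
    e = solve 3 (λ a x y → a :+ (a :+ (x :+ y)) := (a :+ x) :+ (a :+ y)) refl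

  G-mono : ∀ {x y} → x ≤ y → G x ≤ G y
  G-mono {x} x≤y with m≤n⇒∃[o]m+o≡n x≤y
  ... | k , refl = G-mono-+ k
    where
    G-mono-+ : ∀ k → G x ≤ G (x + k)
    G-mono-+ zero    = ≤-reflexive (cong G (sym (+-identityʳ x)))
    G-mono-+ (suc k) = ≤-trans (G-mono-+ k)
      (≤-trans (m≤m+n _ _) (≤-reflexive (trans (sym (G-suc (x + k))) (cong G (sym (+-suc x k))))))

  G-suc-+ : ∀ x s → G (x + suc s) ≡ G (x + s) + g (x + s)
  G-suc-+ x s = trans (cong G (+-suc x s)) (G-suc (x + s))

  G-superadditive : ∀ p s → G p + G s ≤ G (p + s)
  G-superadditive p zero    rewrite G-zero | +-identityʳ p | +-identityʳ (G p) = ≤-refl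
  G-superadditive p (suc s) rewrite G-suc-+ p s | G-suc s | sym (+-assoc (G p) (G s) (g s)) =
    +-mono-≤ (G-superadditive p s) (g-mono-+ s p)

  -- Writing G (x + q) - G x as the sum of g (x + i) over i < q turns this into the q inequalities g
  -- Q + g (r + i) ≤ g (p + i) + g m, each an instance of `g-spread`.
  block-swap : ∀ {p r Q m} q → p ≤ r → p + q ≤ suc Q → Q + r ≤ p + m →
               q * g Q + G (r + q) + G p ≤ q * g m + G (p + q) + G r
  block-swap {p} {r} zero p≤r _ _ rewrite +-identityʳ p | +-identityʳ r = ≤-reflexive (+-comm (G r) (G p))
  block-swap {p} {r} {Q} {m} (suc q) p≤r pq≤Q Qr≤pm rewrite G-suc-+ r q | G-suc-+ p q =
    subst₂ _≤_
      (e₁ (q * g Q) (G (r + q)) (G p) (g Q) (g (r + q)))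
      (e₂ (q * g m) (G (p + q)) (G r) (g (p + q)) (g m))
      (+-mono-≤
        (block-swap q p≤r (≤-trans (+-monoʳ-≤ p (n≤1+n q)) pq≤Q) Qr≤pm)
        (g-spread {p + q} {Q} {r + q} {m}
          (s≤s⁻¹ (subst (_≤ suc Q) (+-suc p q) pq≤Q))
          (+-monoˡ-≤ q p≤r)
          (subst₂ _≤_ (+-assoc Q r q) (e₃ p m q) (+-monoˡ-≤ q Qr≤pm))))
    where
    e₁ = solve 5 (λ a b c d e → a :+ b :+ c :+ (d :+ e) := d :+ a :+ (b :+ e) :+ c) refl
    e₂ = solve 5 (λ a b c d e → a :+ b :+ c :+ (d :+ e) := e :+ a :+ (b :+ d) :+ c) refl
    e₃ = solve 3 (λ a b c → a :+ b :+ c := a :+ c :+ b) refl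

  -- Shortening the Q = p + q full rows by one frees p + q cells; p of them are deleted and the
  -- other q move to the short row, which has room for them.
  f-shrink₁ : ∀ {p q r m} → p ≤ r → r + q ≤ m →
              f m (p + q) (r + q) + (G p + p * g m) ≤ f (suc m) (p + q) r
  f-shrink₁ {p} {q} {r} {m} p≤r rq≤m rewrite G-suc m =
    subst₂ _≤_
      (e₁ p q r m (g (p + q)) (g m) (G m) (G (p + q)) (G (r + q)) (G p))
      (e₂ p q r m (g (p + q)) (g m) (G m) (G (p + q)) (G r))
      (+-monoʳ-≤ ((p + q) * G m + m * G (p + q) + r * g (p + q) + p * g m)
        (block-swap {p} {r} {p + q} {m} q p≤r (n≤1+n _)
          (≤-trans (≤-reflexive (e₃ p q r)) (+-monoʳ-≤ p rq≤m))))
    where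
    e₁ = solve 10 (λ p q r m gQ gm Gm GQ Gr′ Gp →
      (p :+ q) :* Gm :+ m :* GQ :+ r :* gQ :+ p :* gm :+ (q :* gQ :+ Gr′ :+ Gp)
      := (p :+ q) :* Gm :+ m :* GQ :+ (r :+ q) :* gQ :+ Gr′ :+ (Gp :+ p :* gm)) refl
    e₂ = solve 9 (λ p q r m gQ gm Gm GQ Gr →
      (p :+ q) :* Gm :+ m :* GQ :+ r :* gQ :+ p :* gm :+ (q :* gm :+ GQ :+ Gr)
      := (p :+ q) :* (Gm :+ gm) :+ (GQ :+ m :* GQ) :+ r :* gQ :+ Gr) refl
    e₃ = solve 3 (λ p q r → p :+ q :+ r := p :+ (r :+ q)) refl

  -- The overflow case: of the Q - p cells that are freed but not deleted, d - 1 complete the short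
  -- row to length m and s start a new one, so Q grows by one. For d = 0 the short row itself gives
  -- up a cell.
  f-shrink₂ : ∀ {p d s r m Q} → suc Q ≡ p + s + d → suc m ≡ r + d → suc Q ≤ m →
              f m (suc Q) s + (G p + p * g m) ≤ f (suc m) Q r
  f-shrink₂ {p} {d} {s} {r} {m} {Q} Q≡ m≡ Q<m
    rewrite G-suc m | G-suc Q = ≤-cancel (d * g Q + g m + G (p + s))
      (e₁ Q m s d p (G m) (G Q) (g Q) (g (suc Q)) (g m) (G s) (G p) (G (p + s)))
      (+-monoˡ-≤ (Q * G m + m * (G Q + g Q) + p * g m)
        (+-mono-≤ (+-mono-≤ (*-monoʳ-≤ s (g-mono Q<m)) (G-superadditive p s)) swap))
      (trans (e₂ Q m s d p (G m) (G Q) (g Q) (g m) (G r) (G (p + s)))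
        (trans (cong₂ (λ a b → Q * G m + m * G Q + G Q + G r + G (p + s) + a * g m + b * g Q) (sym Q≡) m≡)
          (e₃ Q m d r (G m) (G Q) (g Q) (g m) (G r) (G (p + s)))))
    where
    ps≤r : p + s ≤ r
    ps≤r = +-cancelʳ-≤ d (p + s) r (subst₂ _≤_ Q≡ m≡ (≤-trans Q<m (n≤1+n m)))
    Qr≡ : suc (Q + r) ≡ suc (p + s + m)
    Qr≡ = trans (cong (_+ r) Q≡) (trans (e₄ (p + s) d r) (trans (cong (p + s +_) (sym m≡)) (+-suc (p + s) m)))
      where
      e₄ = solve 3 (λ a b c → a :+ b :+ c := a :+ (c :+ b)) refl
    swap : d * g Q + (G m + g m) + G (p + s) ≤ d * g m + (G Q + g Q) + G r
    swap = subst₂ (λ a b → d * g Q + a + G (p + s) ≤ d * g m + b + G r)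
      (trans (cong G (sym m≡)) (G-suc m)) (trans (cong G (sym Q≡)) (G-suc Q))
      (block-swap d ps≤r (≤-reflexive (sym Q≡)) (≤-reflexive (suc-injective Qr≡)))
    e₁ = solve 13 (λ Q m s d p Gm GQ gQ gQ′ gm Gs Gp Gps →
      (con 1 :+ Q) :* Gm :+ m :* (GQ :+ gQ) :+ s :* gQ′ :+ Gs :+ (Gp :+ p :* gm) :+ (d :* gQ :+ gm :+ Gps)

        := s :* gQ′ :+ (Gp :+ Gs) :+ (d :* gQ :+ (Gm :+ gm) :+ Gps) :+ (Q :* Gm :+ m :* (GQ :+ gQ) :+ p :* gm)) refl
    e₂ = solve 11 (λ Q m s d p Gm GQ gQ gm Gr Gps →
      s :* gm :+ Gps :+ (d :* gm :+ (GQ :+ gQ) :+ Gr) :+ (Q :* Gm :+ m :* (GQ :+ gQ) :+ p :* gm)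
      := Q :* Gm :+ m :* GQ :+ GQ :+ Gr :+ Gps :+ (p :+ s :+ d) :* gm :+ (con 1 :+ m) :* gQ) refl
    e₃ = solve 10 (λ Q m d r Gm GQ gQ gm Gr Gps →
      Q :* Gm :+ m :* GQ :+ GQ :+ Gr :+ Gps :+ (con 1 :+ Q) :* gm :+ (r :+ d) :* gQ
      := Q :* (Gm :+ gm) :+ (GQ :+ m :* GQ) :+ r :* gQ :+ Gr :+ (d :* gQ :+ gm :+ Gps)) refl

  -- D is the slope of g just after c; it gives a support line of the convex function g at c.
  module Support (c D : ℕ) (D≡ : g (suc c) ≡ g c + D) where

    slope-below : ∀ Q s → Q + s ≤ suc c → g (Q + s) ≤ g Q + D * s
    slope-below Q zero    _ rewrite +-identityʳ Q | *-zeroʳ D | +-identityʳ (g Q) = ≤-refl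
    slope-below Q (suc s) h rewrite +-suc Q s = ≤-cancel (g c + g (Q + s))
      (e₁ (g (suc (Q + s))) (g c) (g (Q + s)))
      (+-mono-≤ (increment-mono (s≤s⁻¹ h)) (slope-below Q s (≤-trans (n≤1+n _) h)))
      (trans (cong (λ z → g (Q + s) + z + (g Q + D * s)) D≡) (e₂ (g (Q + s)) (g c) D (g Q) s))
      where
      e₁ = solve 3 (λ a b c → a :+ (b :+ c) := a :+ b :+ c) refl
      e₂ = solve 5 (λ a b D q s →
        a :+ (b :+ D) :+ (q :+ D :* s)
        := q :+ D :* (con 1 :+ s) :+ (b :+ a)) refl

    slope-above : ∀ z → g c + D * z ≤ g (c + z)
    slope-above zero    rewrite *-zeroʳ D | +-identityʳ c | +-identityʳ (g c) = ≤-refl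
    slope-above (suc z) rewrite +-suc c z = ≤-cancel (g c + g (c + z))
      (trans (e₁ (g c) D z (g (c + z))) (cong (λ x → x + g (c + z) + (g c + D * z)) (sym D≡)))
      (+-mono-≤ (increment-mono (m≤m+n c z)) (slope-above z))
      (e₂ (g c) (g (suc (c + z))) (g (c + z)))
      where
      e₁ = solve 4 (λ a D z b →
        a :+ D :* (con 1 :+ z) :+ (a :+ b)
        := (a :+ D) :+ b :+ (a :+ D :* z)) refl
      e₂ = solve 3 (λ a b c → a :+ b :+ c := b :+ (a :+ c)) refl

    support : ∀ y → g c + D * y ≤ g y + D * c
    support y with ≤-total c y
    ... | inj₁ c≤y with m≤n⇒∃[o]m+o≡n c≤y
    ...   | z , refl = subst (_≤ g (c + z) + D * c) (e (g c) D c z) (+-monoˡ-≤ (D * c) (slope-above z))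
      where
      e = solve 4 (λ a D c z → a :+ D :* z :+ D :* c := a :+ D :* (c :+ z)) refl
    support y | inj₂ y≤c with m≤n⇒∃[o]m+o≡n y≤c
    ...   | z , refl = subst (g (y + z) + D * y ≤_) (e (g y) D y z)
                         (+-monoˡ-≤ (D * y) (slope-below y z (n≤1+n _)))
      where
      e = solve 4 (λ a D y z → a :+ D :* z :+ D :* y := a :+ D :* (y :+ z)) refl

    -- Sum over i < q of two estimates: the support line at c evaluated at r′ + i, and g (Q + i) ≤ g
    -- Q + D i from `slope-below`. The terms D i cancel.
    support-sum : ∀ {Q} r′ q → Q + q ≤ suc c →
                  q * g c + G (Q + q) + G r′ + D * (q * r′) ≤ G Q + q * g Q + G (r′ + q) + D * (q * c)
    support-sum {Q} r′ zero    _ rewrite +-identityʳ Q | +-identityʳ r′ | *-zeroʳ D =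
      ≤-reflexive (e (G Q) (G r′))
      where
      e = solve 2 (λ a b → a :+ b :+ con 0 := a :+ con 0 :+ b :+ con 0) refl
    support-sum {Q} r′ (suc q) h rewrite G-suc-+ Q q | G-suc-+ r′ q = ≤-cancel (D * q)
      (e₁ q r′ D (g c) (G (Q + q)) (g (Q + q)) (G r′))
      (+-mono-≤ (+-mono-≤ (support-sum r′ q (≤-trans (+-monoʳ-≤ Q (n≤1+n q)) h)) (support (r′ + q)))
                (slope-below Q q (≤-trans (+-monoʳ-≤ Q (n≤1+n q)) h)))
      (e₂ q c D (G Q) (g Q) (G (r′ + q)) (g (r′ + q)))
      where
      e₁ = solve 7 (λ q r D gc GQq gQq Gr →
        (con 1 :+ q) :* gc :+ (GQq :+ gQq) :+ Gr :+ D :* ((con 1 :+ q) :* r) :+ D :* q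
        := q :* gc :+ GQq :+ Gr :+ D :* (q :* r) :+ (gc :+ D :* (r :+ q)) :+ gQq) refl
      e₂ = solve 7 (λ q c D GQ gQ Grq grq →
        GQ :+ q :* gQ :+ Grq :+ D :* (q :* c) :+ (grq :+ D :* c) :+ (gQ :+ D :* q)
        := GQ :+ (con 1 :+ q) :* gQ :+ (Grq :+ grq) :+ D :* ((con 1 :+ q) :* c) :+ D :* q) refl

  -- The drop consists of Q g m, the q increments of G on the short row, and G Q + q g Q from the
  -- columns. Support lines at c compare it with p = Q + q copies of g c. The leftover linear terms
  -- have the right sign because c is at most the weighted mean of m (Q times) and r′ (q times),
  -- which is the second hypothesis.
  f-shrink₃ : ∀ {Q q r′ m c} → Q + q ≤ suc c → (Q + q) * c ≤ Q * m + q * r′ →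
              f m Q r′ + (G (Q + q) + (Q + q) * g c) ≤ f (suc m) Q (r′ + q)
  f-shrink₃ {Q} {q} {r′} {m} {c} h₁ h₂ with m≤n⇒∃[o]m+o≡n (g-step c)
  ... | D , D≡ rewrite G-suc m = ≤-cancel (D * (Q * m + q * r′) + D * ((Q + q) * c))
      (e₁ Q q r′ m c D (G m) (G Q) (g Q) (G r′) (G (Q + q)) (g c))
      (+-monoʳ-≤ (Q * G m + m * G Q + r′ * g Q)
        (+-mono-≤ (+-mono-≤ (support-sum {Q} r′ q h₁) (*-monoʳ-≤ Q (support m))) (*-monoʳ-≤ D h₂)))
      (e₂ Q q r′ m c D (G m) (g m) (G Q) (g Q) (G (r′ + q)))
    where
    open Support c D (sym D≡)
    e₁ = solve 12 (λ Q q r m c D Gm GQ gQ Gr Gp gc →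
      Q :* Gm :+ m :* GQ :+ r :* gQ :+ Gr :+ (Gp :+ (Q :+ q) :* gc)
        :+ (D :* (Q :* m :+ q :* r) :+ D :* ((Q :+ q) :* c))

        := Q :* Gm :+ m :* GQ :+ r :* gQ
        :+ (q :* gc :+ Gp :+ Gr :+ D :* (q :* r) :+ Q :* (gc :+ D :* m) :+ D :* ((Q :+ q) :* c))) refl
    e₂ = solve 11 (λ Q q r m c D Gm gm GQ gQ Grq →
      Q :* Gm :+ m :* GQ :+ r :* gQ
        :+ (GQ :+ q :* gQ :+ Grq :+ D :* (q :* c) :+ Q :* (gm :+ D :* c) :+ D :* (Q :* m :+ q :* r))

        := Q :* (Gm :+ gm) :+ (GQ :+ m :* GQ) :+ (r :+ q) :* gQ :+ Grq
        :+ (D :* (Q :* m :+ q :* r) :+ D :* ((Q :+ q) :* c))) refl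

  f-grow : ∀ M Q r → f M Q (suc r) ≡ f M Q r + (g Q + g r)
  f-grow M Q r rewrite G-suc r = e (Q * G M + M * G Q) r (g Q) (G r) (g r)
    where
    e = solve 5 (λ a r gQ Gr gr →
      a :+ (con 1 :+ r) :* gQ :+ (Gr :+ gr)
      := a :+ r :* gQ :+ Gr :+ (gQ :+ gr)) refl

  -- The short row is full here: this is the complete bipartite graph with both parts of size Q + 1.
  f-square : ∀ Q → f (suc Q) Q (suc Q) ≡ (suc Q + suc Q) * G (suc Q)
  f-square Q rewrite G-suc Q = e Q (G Q) (g Q)
    where
    e = solve 3 (λ Q GQ gQ →
      Q :* (GQ :+ gQ) :+ (con 1 :+ Q) :* GQ :+ (con 1 :+ Q) :* gQ :+ (GQ :+ gQ)
      := ((con 1 :+ Q) :+ (con 1 :+ Q)) :* (GQ :+ gQ)) refl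

  -- The extremal value drops by at least G p + p g c when a vertex of degree p is deleted and
  -- M decreases from m + 1 to m.
  Shrunk : ℕ → ℕ → ℕ → ℕ → ℕ → ℕ → ℕ → Set
  Shrunk m Q r p c Q′ r′ =
    Q′ * m + r′ + p ≡ Q * suc m + r × 1 ≤ r′ × r′ ≤ m × f m Q′ r′ + (G p + p * g c) ≤ f (suc m) Q r

  -- The cases differ in whether the Q - p surviving cells fit into the short row. With p = 0
  -- nothing is deleted, and the same edges are repacked into rows of length m.
  shrink-low : ∀ {m Q r p} → p ≤ Q → p ≤ r → suc Q ≤ m → 1 ≤ r → r ≤ suc m →
               ∃ λ Q′ → ∃ λ r′ → Shrunk m Q r p m Q′ r′
  shrink-low {m} {Q} {r} {p} p≤Q p≤r Q<m 1≤r r≤M with m≤n⇒∃[o]m+o≡n p≤Q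
  ... | q , refl with r + q ≤? m
  ...   | yes rq≤m = p + q , r + q , e p q r m , ≤-trans 1≤r (m≤m+n r q) , rq≤m , f-shrink₁ p≤r rq≤m
    where
    e = solve 4 (λ p q r m → (p :+ q) :* m :+ (r :+ q) :+ p := (p :+ q) :* (con 1 :+ m) :+ r) refl
  ...   | no rq≰m with m≤n⇒∃[o]m+o≡n r≤M
  ...     | d , r+d≡M with m≤n⇒∃[o]m+o≡n d≤q
    where
    d≤q : d ≤ q
    d≤q = +-cancelˡ-≤ r d q (subst (_≤ r + q) (sym r+d≡M) (≰⇒> rq≰m))
  ...       | s , d+s≡q = suc (p + q) , suc s , count , s≤s z≤n
    , ≤-trans (s≤s (≤-trans (subst (s ≤_) d+s≡q (m≤n+m s d)) (m≤n+m q p))) Q<m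
    , f-shrink₂ {p} {d} {suc s} {r} {m} Q≡ (sym r+d≡M) Q<m
    where
    Q≡ : suc (p + q) ≡ p + suc s + d
    Q≡ = trans (cong (λ x → suc (p + x)) (sym d+s≡q)) (e p d s)
      where
      e = solve 3 (λ p d s → (con 1 :+ (p :+ (d :+ s))) := p :+ (con 1 :+ s) :+ d) refl
    count : suc (p + q) * m + suc s + p ≡ (p + q) * suc m + r
    count = trans (e₁ p q m s) (trans (cong (λ x → x + s + (p + q) * m + p) (sym r+d≡M))
      (trans (e₂ p q r d m s) (trans (cong (λ x → x + r + (p + q) * m + p) d+s≡q) (e₃ p q r m))))
      where
      e₁ = solve 4 (λ p q m s →
        (con 1 :+ (p :+ q)) :* m :+ (con 1 :+ s) :+ p
        := (con 1 :+ m) :+ s :+ (p :+ q) :* m :+ p) refl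
      e₂ = solve 6 (λ p q r d m s →
        r :+ d :+ s :+ (p :+ q) :* m :+ p
        := d :+ s :+ r :+ (p :+ q) :* m :+ p) refl
      e₃ = solve 4 (λ p q r m → q :+ r :+ (p :+ q) :* m :+ p := (p :+ q) :* (con 1 :+ m) :+ r) refl

  -- The Q full rows supply only Q of the p deleted cells; the other q = p - Q come off the short
  -- row, which stays nonempty because p < r.
  shrink-high : ∀ {m Q r p c} → Q < p → p < r → r ≤ suc m → p ≤ suc c → p * suc c ≤ Q * suc m + r →
                ∃ λ r′ → Shrunk m Q r p c Q r′
  shrink-high {m} {Q} {r} {p} {c} Q<p p<r r≤M p≤c pc≤e
    with m≤n⇒∃[o]m+o≡n (<⇒≤ Q<p)
  ... | q , refl with m≤n⇒∃[o]m+o≡n (≤-trans (m≤n+m q Q) (<⇒≤ p<r))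
  ...   | r′ , q+r′≡r with trans (+-comm r′ q) q+r′≡r
  ...     | refl = r′ , e₁ Q q r′ m
    , +-cancelʳ-≤ q 1 r′ (≤-trans (s≤s (m≤n+m q Q)) p<r)
    , s≤s⁻¹ (≤-trans (≤-reflexive (+-comm 1 r′)) (≤-trans (+-monoʳ-≤ r′ 1≤q) r≤M))
    -- Subtracting p from p (c + 1) ≤ e leaves p c ≤ Q m + r′, and r′ ≤ q r′ because q ≥ 1.
    , f-shrink₃ {Q} {q} {r′} {m} p≤c (≤-trans
        (≤-cancel (Q + q) (trans (+-comm _ (Q + q)) (sym (*-suc (Q + q) c)))
          (≤-trans pc≤e (≤-reflexive (e₂ Q q r′ m))) refl)
        (+-monoʳ-≤ (Q * m) (m≤n*m r′ q ⦃ >-nonZero 1≤q ⦄)))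
    where
    1≤q : 1 ≤ q
    1≤q = +-cancelˡ-≤ Q 1 q (≤-trans (≤-reflexive (+-comm Q 1)) Q<p)
    e₁ = solve 4 (λ Q q r m → Q :* m :+ r :+ (Q :+ q) := Q :* (con 1 :+ m) :+ (r :+ q)) refl
    e₂ = solve 4 (λ Q q r m → Q :* (con 1 :+ m) :+ (r :+ q) := Q :* m :+ r :+ (Q :+ q)) refl

-- Degree sums of graphs

sum-mono : ∀ {n} {x y : Fin n → ℕ} → (∀ i → x i ≤ y i) → sum x ≤ sum y
sum-mono {zero}  x≤y = z≤n
sum-mono {suc n} x≤y = +-mono-≤ (x≤y zero) (sum-mono (x≤y ∘ suc))

sum-const : ∀ n c → ∑[ i < n ] c ≡ n * c
sum-const zero    c = refl
sum-const (suc n) c = cong (c +_) (sum-const n c)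

sum-pos : ∀ {n} (x : Fin n → ℕ) → 1 ≤ sum x → ∃ λ i → 1 ≤ x i
sum-pos {suc n} x 1≤ with x zero in eq
... | suc _ = zero , subst (1 ≤_) (sym eq) (s≤s z≤n)
... | zero with sum-pos (x ∘ suc) 1≤
...   | i , h = suc i , h

minimum : ∀ {n} (x : Fin (suc n) → ℕ) → ∃ λ i → ∀ j → x i ≤ x j
minimum {zero}  x = zero , λ { zero → ≤-refl }
minimum {suc n} x with minimum (x ∘ suc)
... | i , least with ≤-total (x zero) (x (suc i))
...   | inj₁ le = zero , λ { zero → ≤-refl ; (suc j) → ≤-trans le (least j) }
...   | inj₂ ge = suc i , λ { zero → ge ; (suc j) → least j }

maximum : ∀ {n} (x : Fin (suc n) → ℕ) → ∃ λ i → ∀ j → x j ≤ x i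
maximum {zero}  x = zero , λ { zero → ≤-refl }
maximum {suc n} x with maximum (x ∘ suc)
... | i , largest with ≤-total (x zero) (x (suc i))
...   | inj₁ le = suc i , λ { zero → le ; (suc j) → largest j }
...   | inj₂ ge = zero , λ { zero → ≤-refl ; (suc j) → ≤-trans (largest j) ge }

bit : Bool → ℕ
bit b = if b then 1 else 0

single : ∀ {n} (u : Fin n) (x : Fin n → ℕ) → ∑[ i < n ] (bit ⌊ i ≟ᶠ u ⌋ * x i) ≡ x u
single {suc n} zero x = trans
  (cong₂ _+_ (*-identityˡ (x zero)) (trans (sum-const n 0) (*-zeroʳ n)))
  (+-identityʳ (x zero))
single {suc n} (suc u) x = trans (sum-cong-≗ {n} shift) (single u (x ∘ suc))
  where
  shift : ∀ i → bit ⌊ suc i ≟ᶠ suc u ⌋ * x (suc i) ≡ bit ⌊ i ≟ᶠ u ⌋ * x (suc i)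
  shift i with i ≟ᶠ u
  ... | yes _ = refl
  ... | no  _ = refl

single-1 : ∀ {n} (u : Fin n) → ∑[ i < n ] bit ⌊ i ≟ᶠ u ⌋ ≡ 1
single-1 u = trans (sum-cong-≗ (λ i → sym (*-identityʳ (bit ⌊ i ≟ᶠ u ⌋)))) (single u (λ _ → 1))

deg : ∀ {n} → Graph n → Fin n → ℕ
deg {n} G v = ∑[ w < n ] bit (adj G v w)

degreeSum : ∀ {n} → (ℕ → ℕ) → Graph n → ℕ
degreeSum {n} Φ G = ∑[ v < n ] Φ (deg G v)

double-injective : ∀ {a b} → a + a ≡ b + b → a ≡ b
double-injective {a} {b} eq = *-cancelˡ-≡ a b 2
  (trans (cong (a +_) (+-identityʳ a)) (trans eq (sym (cong (b +_) (+-identityʳ b)))))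

-- Edge counts across the two sides of a bipartition

module Coloured {n} (G : Graph n) (c : Fin n → Bool)
                (proper : ∀ i j → adj G i j ≡ true → c i ≢ c j) where

  on : Bool → Fin n → ℕ
  on b v = bit ⌊ c v Bool.≟ b ⌋

  side : Bool → ℕ
  side b = ∑[ v < n ] on b v

  sideDeg : Bool → ℕ
  sideDeg b = ∑[ v < n ] (on b v * deg G v)

  on-split : ∀ b v → on b v + on (not b) v ≡ 1
  on-split b v with c v
  on-split true  v | true  = refl
  on-split true  v | false = refl
  on-split false v | true  = refl
  on-split false v | false = refl

  adj⇒on : ∀ v w → adj G v w ≡ true → on (not (c v)) w ≡ 1
  adj⇒on v w vw with c w Bool.≟ not (c v)
  ... | yes _ = refl
  ... | no ne = contradiction (sym (Bool.¬-not ne)) λ eq →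
                  proper v w vw (trans (sym (Bool.not-involutive (c v))) eq)

  sides : ∀ b → side b + side (not b) ≡ n
  sides b = trans (sym (∑-distrib-+ (on b) (on (not b))))
    (trans (sum-cong-≗ (on-split b)) (trans (sum-const n 1) (*-identityʳ n)))

  adj≤on : ∀ v w → bit (adj G v w) ≤ on (not (c v)) w
  adj≤on v w with adj G v w in vw
  ... | false = z≤n
  ... | true  = ≤-reflexive (sym (adj⇒on v w vw))

  deg≤side : ∀ v → deg G v ≤ side (not (c v))
  deg≤side v = sum-mono (adj≤on v)

  -- Double counting: every edge has one end on each side, so exchanging the order of summation
  -- moves the count to the other side.
  sideDeg-swap : ∀ b → sideDeg b ≡ sideDeg (not b)
  sideDeg-swap b = begin
    ∑[ v < n ] (on b v * deg G v)
      ≡⟨ sum-cong-≗ (λ v → *-distribˡ-sum (on b v) (bit ∘ adj G v)) ⟩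
    ∑[ v < n ] ∑[ w < n ] (on b v * bit (adj G v w))   ≡⟨ ∑-comm (λ v w → on b v * bit (adj G v w)) ⟩
    ∑[ w < n ] ∑[ v < n ] (on b v * bit (adj G v w))   ≡⟨ sum-cong-≗ (λ w → sum-cong-≗ (λ v → flip b w v)) ⟩
    ∑[ w < n ] ∑[ v < n ] (on (not b) w * bit (adj G w v))
      ≡⟨ sum-cong-≗ (λ w → *-distribˡ-sum (on (not b) w) (bit ∘ adj G w)) ⟨
    ∑[ w < n ] (on (not b) w * deg G w)                ∎
    where
    open ≡-Reasoning
    flip : ∀ b w v → on b v * bit (adj G v w) ≡ on (not b) w * bit (adj G w v)
    flip b w v rewrite Graph.sym G w v with adj G v w in vw
    ... | false = trans (*-zeroʳ (on b v)) (sym (*-zeroʳ (on (not b) w)))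
    ... | true with c v | c w | proper v w vw
    ...   | true  | true  | ne = contradiction refl ne
    ...   | false | false | ne = contradiction refl ne
    flip true  w v | true | true  | false | ne = refl
    flip false w v | true | true  | false | ne = refl
    flip true  w v | true | false | true  | ne = refl
    flip false w v | true | false | true  | ne = refl

  module _ {e} (handshake : degreeSum id G ≡ e + e) where

    sideDeg≡ : ∀ b → sideDeg b ≡ e
    sideDeg≡ b = double-injective (begin
      sideDeg b + sideDeg b              ≡⟨ cong (sideDeg b +_) (sideDeg-swap b) ⟩
      sideDeg b + sideDeg (not b)
        ≡⟨ ∑-distrib-+ (λ v → on b v * deg G v) (λ v → on (not b) v * deg G v) ⟨
      ∑[ v < n ] (on b v * deg G v + on (not b) v * deg G v) ≡⟨ sum-cong-≗ (λ v →
          trans (sym (*-distribʳ-+ (deg G v) (on b v) (on (not b) v)))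
                (trans (cong (_* deg G v) (on-split b v)) (*-identityˡ _))) ⟩
      degreeSum id G              ≡⟨ handshake ⟩
      e + e                              ∎)
      where open ≡-Reasoning

    edges≤sides : ∀ b → e ≤ side b * side (not b)
    edges≤sides b = begin
      e                                          ≡⟨ sideDeg≡ b ⟨
      sideDeg b                                  ≤⟨ sum-mono bound ⟩
      ∑[ v < n ] (on b v * side (not b))         ≡⟨ *-distribʳ-sum (side (not b)) (on b) ⟨
      side b * side (not b)                      ∎
      where
      open ≤-Reasoning
      bound : ∀ v → on b v * deg G v ≤ on b v * side (not b)
      bound v with c v Bool.≟ b
      ... | yes refl = *-monoʳ-≤ 1 (deg≤side v)
      ... | no  _    = z≤n

    4edges≤square : 4 * e ≤ n * n
    4edges≤square = subst (λ z → 4 * e ≤ z * z) (sides true)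
      (≤-trans (*-monoʳ-≤ 4 (edges≤sides true)) (amgm (side true) (side false)))
      where
      amgm : ∀ x y → 4 * (x * y) ≤ (x + y) * (x + y)
      amgm x y with ≤-total x y
      ... | inj₁ x≤y with m≤n⇒∃[o]m+o≡n x≤y
      ...   | k , refl = ≤-trans (m≤m+n _ (k * k)) (≤-reflexive (eq x k))
        where
        eq : ∀ x k → 4 * (x * (x + k)) + k * k ≡ (x + (x + k)) * (x + (x + k))
        eq = solve 2 (λ x k → con 4 :* (x :* (x :+ k)) :+ k :* k := (x :+ (x :+ k)) :* (x :+ (x :+ k))) refl
      amgm x y | inj₂ y≤x with m≤n⇒∃[o]m+o≡n y≤x
      ...   | k , refl = ≤-trans (m≤m+n _ (k * k)) (≤-reflexive (eq y k))
        where
        eq : ∀ y k → 4 * ((y + k) * y) + k * k ≡ (y + k + y) * (y + k + y)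
        eq = solve 2 (λ y k → con 4 :* ((y :+ k) :* y) :+ k :* k := (y :+ k :+ y) :* (y :+ k :+ y)) refl

    -- The neighbours of u lie on one side, so their degrees add up to at most e.
    minDeg*deg≤edges : ∀ {p} → (∀ v → p ≤ deg G v) → ∀ u → p * deg G u ≤ e
    minDeg*deg≤edges {p} p≤deg u = begin
      p * deg G u                                          ≡⟨ *-comm p (deg G u) ⟩
      deg G u * p                                          ≡⟨ *-distribʳ-sum p (bit ∘ adj G u) ⟩
      ∑[ w < n ] (bit (adj G u w) * p)                     ≤⟨ sum-mono (λ w → *-mono-≤ (adj≤on u w) (p≤deg w)) ⟩
      sideDeg (not (c u))                                  ≡⟨ sideDeg≡ (not (c u)) ⟩
      e                                                    ∎
      where open ≤-Reasoning

    -- A vertex of degree above M would have x > M vertices opposite to it. As x + y = M + 1 + Q,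
    -- the product x y, and with it e, would be at most Q (M + 1).
    deg-bound : ∀ {M Q} → n ≡ suc M + Q → Q ≤ M → Q * suc M < e → ∀ v → deg G v ≤ M
    deg-bound {M} {Q} n≡ Q≤M Q<e v = ≮⇒≥ λ M<d →
      <⇒≱ Q<e (≤-trans (edges≤sides (not (c v))) (bound (≤-trans M<d (deg≤side v)) (trans (sides (not (c v))) n≡)))
      where
      bound : ∀ {x y} → suc M ≤ x → x + y ≡ suc M + Q → x * y ≤ Q * suc M
      bound {y = y} M<x x+y≡ with m≤n⇒∃[o]m+o≡n M<x
      ... | z , refl with +-cancelˡ-≡ (suc M) (z + y) Q (trans (sym (+-assoc (suc M) z y)) x+y≡)
      ...   | refl = begin
        (suc M + z) * y           ≡⟨ *-distribʳ-+ y (suc M) z ⟩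
        suc M * y + z * y
          ≤⟨ +-monoʳ-≤ (suc M * y) (*-monoʳ-≤ z (≤-trans (m≤n+m y z) (≤-trans Q≤M (n≤1+n M)))) ⟩
        suc M * y + z * suc M     ≡⟨ solve 3 (λ a y z → a :* y :+ z :* a := (z :+ y) :* a) refl (suc M) y z ⟩
        (z + y) * suc M           ∎
        where open ≤-Reasoning

    complete⇒sides≤edges : (∀ v w → c v ≢ c w → adj G v w ≡ true) → ∀ b → side b * side (not b) ≤ e
    complete⇒sides≤edges full b = begin
      side b * side (not b)                      ≡⟨ *-distribʳ-sum (side (not b)) (on b) ⟩
      ∑[ v < n ] (on b v * side (not b))         ≤⟨ sum-mono bound ⟩
      sideDeg b                                  ≡⟨ sideDeg≡ b ⟩
      e                                          ∎
      where
      open ≤-Reasoning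
      on≤adj : ∀ v w → on (not (c v)) w ≤ bit (adj G v w)
      on≤adj v w with c w Bool.≟ not (c v)
      ... | no  _  = z≤n
      ... | yes eq rewrite full v w (λ eq′ → Bool.not-¬ {c v} refl (trans eq′ eq)) = ≤-refl
      bound : ∀ v → on b v * side (not b) ≤ on b v * deg G v
      bound v with c v Bool.≟ b
      ... | yes refl = *-monoʳ-≤ 1 (sum-mono (on≤adj v))
      ... | no  _    = z≤n

  -- The side opposite to v contains the neighbours of v. As r ≥ 1, v has a neighbour, whose own
  -- neighbours lie on the side of v.
  minDeg≤sides : ∀ {r} → 1 ≤ r → (∀ v → r ≤ deg G v) → (v : Fin n) → ∀ b → r ≤ side b
  minDeg≤sides {r} 1≤r r≤deg v b with sum-pos (bit ∘ adj G v) (≤-trans 1≤r (r≤deg v))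
  ... | w , vw with c v Bool.≟ b | Bool.¬-not
  ...   | no ne | ¬-not = subst (λ b → r ≤ side b) (trans (cong not (¬-not ne)) (Bool.not-involutive b))
                             (≤-trans (r≤deg v) (deg≤side v))
  ...   | yes refl | ¬-not with adj G v w in eq
  ...     | true = subst (λ b → r ≤ side b)
      (trans (cong not (¬-not (proper v w eq ∘ sym))) (Bool.not-involutive (c v))) (≤-trans (r≤deg w) (deg≤side w))

-- Deleting a vertex and adding an edge

remove : ∀ {n} → Graph (suc n) → Fin (suc n) → Graph n
remove G v = record
  { adj    = λ i j → adj G (punchIn v i) (punchIn v j)
  ; sym    = λ i j → Graph.sym G (punchIn v i) (punchIn v j)
  ; irrefl = λ i → irrefl G (punchIn v i)
  }

module Removal {n} (G : Graph (suc n)) (v : Fin (suc n)) where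

  link : Fin n → ℕ
  link i = bit (adj G v (punchIn v i))

  deg-punchIn : ∀ i → deg G (punchIn v i) ≡ link i + deg (remove G v) i
  deg-punchIn i = trans (sum-remove {i = v} (bit ∘ adj G (punchIn v i)))
    (cong (λ b → bit b + deg (remove G v) i) (Graph.sym G (punchIn v i) v))

  sum-link : sum link ≡ deg G v
  sum-link = sym (trans (sum-remove {i = v} (bit ∘ adj G v)) (cong (λ b → bit b + sum link) (irrefl G v)))

  degreeSum-remove : ∀ Φ → degreeSum Φ G ≡ Φ (deg G v) + ∑[ i < n ] Φ (link i + deg (remove G v) i)
  degreeSum-remove Φ = trans (sum-remove {i = v} (Φ ∘ deg G))
    (cong (Φ (deg G v) +_) (sum-cong-≗ (λ i → cong Φ (deg-punchIn i))))

  handshake-remove : degreeSum id G ≡ deg G v + deg G v + degreeSum id (remove G v)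
  handshake-remove = trans (degreeSum-remove id)
    (trans (cong (deg G v +_) (trans (∑-distrib-+ link (deg (remove G v)))
                                     (cong (_+ degreeSum id (remove G v)) sum-link)))
      (sym (+-assoc (deg G v) (deg G v) _)))

remove-bipartite : ∀ {n} (G : Graph (suc n)) v → IsBipartite G → IsBipartite (remove G v)
remove-bipartite G v (c , proper) = c ∘ punchIn v , λ i j → proper (punchIn v i) (punchIn v j)

module AddEdge {n} (G : Graph n) {u w : Fin n} (u≢w : u ≢ w) (uw : adj G u w ≡ false) where

  joins : Fin n → Fin n → Bool
  joins i j = (⌊ i ≟ᶠ u ⌋ ∧ ⌊ j ≟ᶠ w ⌋) ∨ (⌊ i ≟ᶠ w ⌋ ∧ ⌊ j ≟ᶠ u ⌋)

  joins-sym : ∀ i j → joins i j ≡ joins j i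
  joins-sym i j = trans (Bool.∨-comm (⌊ i ≟ᶠ u ⌋ ∧ ⌊ j ≟ᶠ w ⌋) _)
    (cong₂ _∨_ (Bool.∧-comm ⌊ i ≟ᶠ w ⌋ _) (Bool.∧-comm ⌊ i ≟ᶠ u ⌋ _))

  joins-irrefl : ∀ i → joins i i ≡ false
  joins-irrefl i with i ≟ᶠ u | i ≟ᶠ w
  ... | yes refl | yes refl = contradiction refl u≢w
  ... | yes _    | no  _    = refl
  ... | no  _    | yes _    = refl
  ... | no  _    | no  _    = refl

  addEdge : Graph n
  addEdge = record
    { adj    = λ i j → adj G i j ∨ joins i j
    ; sym    = λ i j → cong₂ _∨_ (Graph.sym G i j) (joins-sym i j)
    ; irrefl = λ i → cong₂ _∨_ (irrefl G i) (joins-irrefl i)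
    }

  addEdge-bipartite : ((c , _) : IsBipartite G) → c u ≢ c w → IsBipartite addEdge
  addEdge-bipartite (c , proper) cu≢cw = c , proper′
    where
    proper′ : ∀ i j → adj addEdge i j ≡ true → c i ≢ c j
    proper′ i j ij with adj G i j in eq
    ... | true  = proper i j eq
    ... | false with i ≟ᶠ u | j ≟ᶠ w | i ≟ᶠ w | j ≟ᶠ u
    ...   | yes refl | yes refl | _        | _        = cu≢cw
    ...   | _        | _        | yes refl | yes refl = cu≢cw ∘ sym
    proper′ i j () | false | yes _ | no _  | yes _ | no _
    proper′ i j () | false | yes _ | no _  | no _  | _
    proper′ i j () | false | no _  | _     | yes _ | no _
    proper′ i j () | false | no _  | _     | no _  | _

  end : Fin n → Fin n → ℕ
  end x i = bit ⌊ i ≟ᶠ x ⌋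

  bit-addEdge : ∀ i j → bit (adj addEdge i j) ≡ bit (adj G i j) + (end u i * end w j + end w i * end u j)
  bit-addEdge i j with i ≟ᶠ u | j ≟ᶠ w | i ≟ᶠ w | j ≟ᶠ u
  ... | yes refl | yes refl | yes refl | _        = contradiction refl u≢w
  ... | yes refl | yes refl | no _     | _        rewrite uw = refl
  ... | yes refl | no _     | yes refl | _        = contradiction refl u≢w
  ... | yes refl | no _     | no _     | _        rewrite Bool.∨-identityʳ (adj G i j) = sym (+-identityʳ _)
  ... | no _     | _        | yes refl | yes refl rewrite Graph.sym G w u | uw = refl
  ... | no _     | _        | yes refl | no _     rewrite Bool.∨-identityʳ (adj G i j) = sym (+-identityʳ _)
  ... | no _     | _        | no _     | _        rewrite Bool.∨-identityʳ (adj G i j) = sym (+-identityʳ _)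

  deg-addEdge : ∀ i → deg addEdge i ≡ deg G i + (end u i + end w i)
  deg-addEdge i = begin
    ∑[ j < n ] bit (adj addEdge i j)                                          ≡⟨ sum-cong-≗ (bit-addEdge i) ⟩
    ∑[ j < n ] (bit (adj G i j) + (end u i * end w j + end w i * end u j))    ≡⟨ ∑-distrib-+ (bit ∘ adj G i) _ ⟩
    deg G i + ∑[ j < n ] (end u i * end w j + end w i * end u j)
      ≡⟨ cong (deg G i +_) (∑-distrib-+ (λ j → end u i * end w j) _) ⟩
    deg G i + (∑[ j < n ] (end u i * end w j) + ∑[ j < n ] (end w i * end u j))
      ≡⟨ cong (deg G i +_) (cong₂ _+_ (total u w) (total w u)) ⟩
    deg G i + (end u i + end w i) ∎
    where
    open ≡-Reasoning
    total : ∀ x y → ∑[ j < n ] (end x i * end y j) ≡ end x i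
    total x y = trans (sym (*-distribˡ-sum (end x i) (end y)))
      (trans (cong (end x i *_) (single-1 y)) (*-identityʳ _))

  handshake-addEdge : degreeSum id addEdge ≡ degreeSum id G + 2
  handshake-addEdge = trans (sum-cong-≗ deg-addEdge) (trans (∑-distrib-+ (deg G) _)
    (cong (degreeSum id G +_) (trans (∑-distrib-+ (end u) (end w)) (cong₂ _+_ (single-1 u) (single-1 w)))))

module _ {G g : ℕ → ℕ} (cp : ConvexPrimitive G g) where
  open ConvexPrimitive cp
  open Convexity cp

  -- A neighbour of v keeps at most c neighbours after the deletion, so its term falls by at most g
  -- c.
  degreeSum-remove-≤ : ∀ {n} (B : Graph (suc n)) v {c} → (∀ w → deg B w ≤ suc c) →
                       degreeSum G B ≤ degreeSum G (remove B v) + (G (deg B v) + deg B v * g c)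
  degreeSum-remove-≤ {n} B v {c} deg≤ = begin
    degreeSum G B                                               ≡⟨ degreeSum-remove G ⟩
    G p + ∑[ i < n ] G (link i + deg B′ i)                      ≤⟨ +-monoʳ-≤ (G p) (sum-mono grow) ⟩
    G p + ∑[ i < n ] (G (deg B′ i) + link i * g c)              ≡⟨ cong (G p +_) (∑-distrib-+ (G ∘ deg B′) _) ⟩
    G p + (degreeSum G B′ + ∑[ i < n ] (link i * g c))
      ≡⟨ cong (λ x → G p + (degreeSum G B′ + x)) (*-distribʳ-sum (g c) link) ⟨
    G p + (degreeSum G B′ + sum link * g c)
      ≡⟨ cong (λ x → G p + (degreeSum G B′ + x * g c)) sum-link ⟩
    G p + (degreeSum G B′ + p * g c)
      ≡⟨ solve 3 (λ a b c → a :+ (b :+ c) := b :+ (a :+ c)) refl (G p) (degreeSum G B′) (p * g c) ⟩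
    degreeSum G B′ + (G p + p * g c)                            ∎
    where
    open ≤-Reasoning
    open Removal B v
    p = deg B v
    B′ = remove B v
    grow : ∀ i → G (link i + deg B′ i) ≤ G (deg B′ i) + link i * g c
    grow i with adj B v (punchIn v i) | deg-punchIn i
    ... | false | _  = ≤-reflexive (sym (+-identityʳ _))
    ... | true  | eq rewrite G-suc (deg B′ i) | +-identityʳ (g c) =
      +-monoʳ-≤ (G (deg B′ i)) (g-mono (s≤s⁻¹ (≤-trans (≤-reflexive (sym eq)) (deg≤ (punchIn v i)))))

  degreeSum-addEdge-≥ : ∀ {n} (B : Graph n) {u w} (u≢w : u ≢ w) (uw : adj B u w ≡ false) →
                        degreeSum G B + (g (deg B u) + g (deg B w)) ≤ degreeSum G (AddEdge.addEdge B u≢w uw)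
  degreeSum-addEdge-≥ {n} B {u} {w} u≢w uw = begin
    degreeSum G B + (g (deg B u) + g (deg B w))
      ≡⟨ cong (degreeSum G B +_) (cong₂ _+_ (single u (g ∘ deg B)) (single w (g ∘ deg B))) ⟨
    degreeSum G B + (∑[ i < n ] (end u i * g (deg B i)) + ∑[ i < n ] (end w i * g (deg B i)))
      ≡⟨ cong (degreeSum G B +_) (∑-distrib-+ (λ i → end u i * g (deg B i)) _) ⟨
    degreeSum G B + ∑[ i < n ] (end u i * g (deg B i) + end w i * g (deg B i))
      ≡⟨ ∑-distrib-+ (G ∘ deg B) _ ⟨
    ∑[ i < n ] (G (deg B i) + (end u i * g (deg B i) + end w i * g (deg B i)))
      ≤⟨ sum-mono grow ⟩
    degreeSum G addEdge ∎
    where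
    open ≤-Reasoning
    open AddEdge B u≢w uw
    grow : ∀ i → G (deg B i) + (end u i * g (deg B i) + end w i * g (deg B i)) ≤ G (deg addEdge i)
    grow i rewrite deg-addEdge i with i ≟ᶠ u | i ≟ᶠ w
    ... | yes refl | yes refl = contradiction refl u≢w
    ... | no _     | no _     rewrite +-identityʳ (G (deg B i)) | +-identityʳ (deg B i) = ≤-refl
    ... | yes refl | no _     rewrite +-comm (deg B i) 1 | G-suc (deg B i) =
      ≤-reflexive (cong (G (deg B i) +_) (trans (+-identityʳ _) (+-identityʳ _)))
    ... | no _     | yes refl rewrite +-comm (deg B i) 1 | G-suc (deg B i) =
      ≤-reflexive (cong (G (deg B i) +_) (+-identityʳ _))

-- The extremal inequality

-- (r + α) (r + β) ≥ r (M + Q + 1 - r), which exceeds Q M + r because Q < r ≤ M.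
many-edges : ∀ {x y r M Q} → r ≤ x → r ≤ y → x + y ≡ suc M + Q → Q < r → suc Q < M → Q * M + r < x * y
many-edges {r = r} {M} {Q} r≤x r≤y x+y≡ Q<r Q<M
  with m≤n⇒∃[o]m+o≡n r≤x | m≤n⇒∃[o]m+o≡n r≤y | m≤n⇒∃[o]m+o≡n Q<r
... | α , refl | β , refl | γ , refl
  with +-cancelʳ-≡ (suc Q) M _ (trans (trans (+-suc M Q) (sym x+y≡)) (e Q α β γ))
  where
  e : ∀ Q α β γ → suc Q + γ + α + (suc Q + γ + β) ≡ γ + (suc Q + γ + (α + β)) + suc Q
  e = solve 4 (λ Q α β γ → con 1 :+ Q :+ γ :+ α :+ (con 1 :+ Q :+ γ :+ β)
        := γ :+ (con 1 :+ Q :+ γ :+ (α :+ β)) :+ (con 1 :+ Q)) refl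
... | refl = ≤-trans (≤-trans (≤-reflexive (+-comm 1 _)) (+-monoʳ-≤ K 1≤γ+δ))
    (≤-trans (m≤m+n _ (γ * γ + γ * (α + β) + α * β)) (≤-reflexive (e Q α β γ)))
  where
  K = Q * (γ + (suc Q + γ + (α + β))) + (suc Q + γ)
  pos : ∀ γ δ → suc (suc Q) ≤ γ + (suc Q + γ + δ) → 1 ≤ γ + δ
  pos zero    δ h = +-cancelˡ-≤ (suc Q) 1 δ (subst₂ _≤_ (+-comm 1 (suc Q)) (cong (_+ δ) (+-identityʳ (suc Q))) h)
  pos (suc γ) δ h = s≤s z≤n
  1≤γ+δ : 1 ≤ γ + (α + β)
  1≤γ+δ = pos γ (α + β) Q<M
  e = solve 4 (λ Q α β γ →
    Q :* (γ :+ ((con 1 :+ Q) :+ γ :+ (α :+ β))) :+ ((con 1 :+ Q) :+ γ)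
      :+ (γ :+ (α :+ β)) :+ (γ :* γ :+ γ :* (α :+ β) :+ α :* β)
    := ((con 1 :+ Q) :+ γ :+ α) :* ((con 1 :+ Q) :+ γ :+ β)) refl

-- Comparing 4 Q M < 4 e ≤ n² ≤ 4 M² for M = m + 1 gives Q ≤ m. Integrality excludes Q = m: then n ≤
-- 2 Q + 1, so n² ≤ 4 Q (Q + 1) + 1, whereas 4 e ≥ 4 Q (Q + 1) + 4.
few-edges⇒wide : ∀ {m Q n e} → Q * suc m < e → 4 * e ≤ n * n → n ≤ suc m + suc m → n ≤ suc m + Q → Q < m
few-edges⇒wide {m} {Q} {n} {e} Q<e 4e≤n² n≤2M n≤M+Q
  with m≤n⇒∃[o]m+o≡n (s≤s⁻¹ Q<M)
  where
  Q<M : Q < suc m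
  Q<M = *-cancelʳ-< (suc m) Q (suc m) (*-cancelˡ-< 4 _ _ (<-≤-trans (*-monoʳ-< 4 Q<e)
    (≤-trans 4e≤n² (≤-trans (*-mono-≤ n≤2M n≤2M) (≤-reflexive (e₀ (suc m)))))))
    where
    e₀ = solve 1 (λ a → (a :+ a) :* (a :+ a) := con 4 :* (a :* a)) refl
... | suc z , refl = ≤-trans (≤-reflexive (+-comm 1 Q)) (+-monoʳ-≤ Q (s≤s z≤n))
... | zero  , refl = contradiction (+-cancelˡ-≤ (4 * (Q * suc (Q + 0))) 4 1 (begin
    4 * (Q * suc (Q + 0)) + 4             ≡⟨ e₁ (Q * suc (Q + 0)) ⟩
    4 * suc (Q * suc (Q + 0))             ≤⟨ *-monoʳ-≤ 4 Q<e ⟩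
    4 * e                                 ≤⟨ 4e≤n² ⟩
    n * n                                 ≤⟨ *-mono-≤ n≤M+Q n≤M+Q ⟩
    (suc (Q + 0) + Q) * (suc (Q + 0) + Q) ≡⟨ e₂ Q ⟩
    4 * (Q * suc (Q + 0)) + 1             ∎)) λ { (s≤s ()) }
  where
  open ≤-Reasoning
  e₁ = solve 1 (λ a → con 4 :* a :+ con 4 := con 4 :* (con 1 :+ a)) refl
  e₂ = solve 1 (λ Q →
    ((con 1 :+ (Q :+ con 0)) :+ Q) :* ((con 1 :+ (Q :+ con 0)) :+ Q)
    := con 4 :* (Q :* (con 1 :+ (Q :+ con 0))) :+ con 1) refl

module Extremal {G g : ℕ → ℕ} (cp : ConvexPrimitive G g) where
  open Convexity cp

  -- The hypotheses say that, with M = suc m, no bipartition of n vertices with a part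
  -- larger than M carries e = Q M + r edges; k bounds the number of ordered non-adjacent pairs.
  Bound : ℕ → ℕ → ℕ → Set
  Bound n k m = (B : Graph n) → IsBipartite B → ∀ {Q r} →
    degreeSum id B ≡ (Q * suc m + r) + (Q * suc m + r) → n * n ≤ degreeSum id B + k →
    1 ≤ r → r ≤ suc m → n ≤ suc m + suc m →
    (∀ t → n ≡ suc (suc m) + t → t * suc (suc m) < Q * suc m + r) →
    degreeSum G B ≤ f (suc m) Q r

  module Step {n k m}
              (smaller-M : ∀ m′ → m ≡ suc m′ → Bound (suc n) (suc k) m′)
              (more-edges : Bound (suc n) k m)
              (fewer-vertices : ∀ k′ m′ → Bound n k′ m′)
              (B : Graph (suc n)) (bipartite : IsBipartite B) {Q r}
              (handshake : degreeSum id B ≡ (Q * suc m + r) + (Q * suc m + r))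
              (fuel : suc n * suc n ≤ degreeSum id B + suc k)
              (1≤r : 1 ≤ r) (r≤M : r ≤ suc m) (n≤2M : suc n ≤ suc m + suc m)
              (short : ∀ t → suc n ≡ suc (suc m) + t → t * suc (suc m) < Q * suc m + r) where

    open Coloured B (proj₁ bipartite) (proj₂ bipartite)
    c = proj₁ bipartite

    predecessor : ∀ {a b} → a < b → ∃ λ b′ → b ≡ suc b′
    predecessor {b = suc b} _ = b , refl

    Q*M<e : Q * suc m < Q * suc m + r
    Q*M<e = m<m+n (Q * suc m) 1≤r

    -- For some t ≥ Q + 1, `short` would give (Q + 1) (M + 1) < e, while r ≤ M gives e ≤ (Q + 1) M.
    too-many-vertices : suc m + suc Q < suc n → ⊥
    too-many-vertices lt with m≤n⇒∃[o]m+o≡n lt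
    ... | t , eq = <-irrefl refl (<-≤-trans (short (suc Q + t)
      (sym (trans (sym (+-assoc (suc (suc m)) (suc Q) t)) eq)))
      (begin
        Q * suc m + r                       ≤⟨ +-monoʳ-≤ (Q * suc m) r≤M ⟩
        Q * suc m + suc m                   ≡⟨ +-comm (Q * suc m) (suc m) ⟩
        suc Q * suc m                       ≤⟨ *-mono-≤ (m≤m+n (suc Q) t) (n≤1+n (suc m)) ⟩
        (suc Q + t) * suc (suc m)           ∎))
      where open ≤-Reasoning

    -- The extremal graph has more vertices than B. Repacking with p = 0 keeps e and replaces M by M
    -- - 1 without raising the value, so the claim for the smaller M suffices.
    few-vertices : suc n ≤ suc m + Q → degreeSum G B ≤ f (suc m) Q r
    few-vertices n≤M+Q with few-edges⇒wide {m} {Q} Q*M<e (4edges≤square {Q * suc m + r} handshake) n≤2M n≤M+Q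
    ... | Q<m with predecessor Q<m | shrink-low {m} {Q} {r} {0} z≤n z≤n Q<m 1≤r r≤M
    ...   | m′ , refl | Q′ , r′ , count , 1≤r′ , r′≤m , f≤ =
      ≤-trans (smaller-M m′ refl B bipartite {Q′} {r′}
        (trans handshake (cong₂ _+_ (sym count′) (sym count′))) fuel 1≤r′ r′≤m
        (≤-trans n≤M+Q (≤-trans (≤-reflexive (sym (+-suc m Q))) (+-monoʳ-≤ m Q<m)))
        -- With M lowered to m, the premise n = m + 1 + t forces t ≤ Q, hence t (m + 1) ≤ Q (m + 1)
        -- < e.
        (λ t eq → ≤-trans (s≤s (*-monoˡ-≤ (suc m) (+-cancelˡ-≤ (suc m) t Q (subst (_≤ suc m + Q) eq n≤M+Q))))
                          (≤-trans Q*M<e (≤-reflexive (sym count′)))))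
      (≤-trans (m≤m+n _ _) f≤)
      where
      count′ : Q′ * m + r′ ≡ Q * suc m + r
      count′ = trans (sym (+-identityʳ _)) count

    module Tight (n≡ : suc n ≡ suc m + suc Q) where

      n≡′ : suc n ≡ suc (suc m) + Q
      n≡′ = trans n≡ (cong suc (+-suc m Q))

      Q≤m : Q ≤ m
      Q≤m = s≤s⁻¹ (+-cancelˡ-≤ (suc m) (suc Q) (suc m) (subst (_≤ suc m + suc m) n≡ n≤2M))

      -- At t = Q, `short` reads Q (M + 1) < Q M + r.
      Q<r : Q < r
      Q<r = +-cancelˡ-< (Q * suc m) Q r (subst (_< Q * suc m + r)
        (trans (*-suc Q (suc m)) (+-comm Q _)) (short Q n≡′))

      deg≤M : ∀ v → deg B v ≤ suc m
      deg≤M = deg-bound handshake n≡′ (≤-trans Q≤m (n≤1+n m)) (short Q n≡′)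

      -- Here Q < r ≤ M leaves only r = M, so the extremal graph is complete with both parts of size
      -- M, and `deg≤M` already bounds every term.
      balanced : Q ≡ m → degreeSum G B ≤ f (suc m) Q r
      balanced refl with ≤-antisym r≤M Q<r
      ... | refl = begin
        degreeSum G B                  ≤⟨ sum-mono (λ v → G-mono (deg≤M v)) ⟩
        sum {suc n} (λ _ → G (suc m))  ≡⟨ sum-const (suc n) (G (suc m)) ⟩
        suc n * G (suc m)              ≡⟨ cong (_* G (suc m)) n≡ ⟩
        (suc m + suc m) * G (suc m)    ≡⟨ f-square m ⟨
        f (suc m) m (suc m)            ∎
        where open ≤-Reasoning

      module Unbalanced (Q<m : Q < m) (v : Fin (suc n)) (p≤deg : ∀ w → deg B v ≤ deg B w) where

        p = deg B v

        remove-vertex : p < r → ∀ {c Q′ r′} → (∀ w → deg B w ≤ suc c) → Shrunk m Q r p c Q′ r′ →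
                        degreeSum G B ≤ f (suc m) Q r
        remove-vertex p<r {c} {Q′} {r′} deg≤ (count , 1≤r′ , r′≤m , f≤) with predecessor Q<m
        ... | m′ , refl = begin
          degreeSum G B                              ≤⟨ degreeSum-remove-≤ cp B v deg≤ ⟩
          degreeSum G (remove B v) + (G p + p * g c) ≤⟨ +-monoˡ-≤ (G p + p * g c) rest ⟩
          f m Q′ r′ + (G p + p * g c)                ≤⟨ f≤ ⟩
          f (suc m) Q r                              ∎
          where
          open ≤-Reasoning
          e′ = Q′ * m + r′
          n≡m+ : n ≡ m + suc Q
          n≡m+ = suc-injective n≡
          handshake′ : degreeSum id (remove B v) ≡ e′ + e′
          handshake′ = +-cancelˡ-≡ (p + p) _ _ (trans (sym (Removal.handshake-remove B v)) (trans handshake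
            (trans (cong₂ _+_ (sym count) (sym count))
              (solve 2 (λ e p → e :+ p :+ (e :+ p) := p :+ p :+ (e :+ e)) refl e′ p))))
          -- The only candidate is t = Q, and e′ = Q (m + 1) + r - p exceeds Q (m + 1) exactly
          -- because p < r.
          short′ : ∀ t → n ≡ suc m + t → t * suc m < e′
          short′ t eq with +-cancelˡ-≡ (suc m) t Q (trans (sym eq) (trans n≡m+ (+-suc m Q)))
          ... | refl = +-cancelʳ-< p (Q * suc m) e′ (≤-trans (+-monoʳ-< (Q * suc m) p<r) (≤-reflexive (sym count)))
          rest : degreeSum G (remove B v) ≤ f m Q′ r′
          rest = fewer-vertices (n * n) m′ (remove B v) (remove-bipartite B v bipartite) {Q′} {r′}
            handshake′ (m≤n+m (n * n) _) 1≤r′ r′≤m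
            (≤-trans (≤-reflexive n≡m+) (+-monoʳ-≤ m Q<m)) short′

        low-degree : p < r → degreeSum G B ≤ f (suc m) Q r
        low-degree p<r with p ≤? Q
        ... | yes p≤Q with shrink-low {m} {Q} {r} {p} p≤Q (<⇒≤ p<r) Q<m 1≤r r≤M
        ...   | Q′ , r′ , shrunk = remove-vertex p<r {m} {Q′} {r′} deg≤M shrunk
        low-degree p<r | no p≰Q with maximum (deg B)
        ... | u , deg≤A with deg B u in eq
        ...   | zero  = contradiction (subst (p ≤_) eq (p≤deg u)) (<⇒≱ (≤-trans (s≤s z≤n) (≰⇒> p≰Q)))
        ...   | suc a with shrink-high {m} {Q} {r} {p} {a} (≰⇒> p≰Q) p<r r≤M (subst (p ≤_) eq (p≤deg u))
                             (subst (λ A → p * A ≤ Q * suc m + r) eq (minDeg*deg≤edges handshake p≤deg u))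
        ...     | r′ , shrunk = remove-vertex p<r {a} {Q} {r′} deg≤A shrunk

        -- Both sides have at least r vertices, so if every cross pair were adjacent, `many-edges`
        -- would give more than e edges. A missing cross pair can therefore be joined.
        high-degree : r ≤ p → degreeSum G B ≤ f (suc m) Q r
        high-degree r≤p with any? (λ u → any? (λ w → ¬? (c u Bool.≟ c w) ×-dec (adj B u w Bool.≟ false)))
        ... | no none = contradiction
            (complete⇒sides≤edges handshake (λ u w cu≢cw → Bool.¬-not λ uw → none (u , w , cu≢cw , uw)) true)
            (<⇒≱ (many-edges (r≤side true) (r≤side false) (trans (sides true) n≡′) Q<r (s≤s Q<m)))
          where
          r≤side : ∀ b → r ≤ side b
          r≤side = minDeg≤sides 1≤r (λ w → ≤-trans r≤p (p≤deg w)) v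
        ... | yes (u , w , cu≢cw , uw) = +-cancelʳ-≤ (g Q + g r) _ _ (begin
            degreeSum G B + (g Q + g r)
              ≤⟨ +-monoʳ-≤ (degreeSum G B) (+-mono-≤ (g-mono (≤-trans (<⇒≤ Q<r) (r≤deg u))) (g-mono (r≤deg w))) ⟩
            degreeSum G B + (g (deg B u) + g (deg B w)) ≤⟨ degreeSum-addEdge-≥ cp B u≢w uw ⟩
            degreeSum G addEdge
              ≤⟨ more-edges addEdge (addEdge-bipartite bipartite cu≢cw) {Q} {suc r}
                                                          handshake′ fuel′ (s≤s z≤n) r<M n≤2M short′ ⟩
            f (suc m) Q (suc r)                       ≡⟨ f-grow (suc m) Q r ⟩
            f (suc m) Q r + (g Q + g r)               ∎)
          where
          open ≤-Reasoning
          u≢w : u ≢ w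
          u≢w u≡w = cu≢cw (cong c u≡w)
          open AddEdge B u≢w uw
          r≤deg : ∀ x → r ≤ deg B x
          r≤deg x = ≤-trans r≤p (p≤deg x)
          r≤side : ∀ b → r ≤ side b
          r≤side = minDeg≤sides 1≤r r≤deg v
          -- The short row must have room for one more cell. If r = M, both sides would have at
          -- least M vertices, so 2 M ≤ n = M + Q + 1, against Q < m.
          r<M : r < suc m
          r<M = ≤∧≢⇒< r≤M λ { refl → <⇒≱ (s≤s Q<m) (+-cancelˡ-≤ (suc m) (suc m) (suc Q)
            (≤-trans (+-mono-≤ (r≤side true) (r≤side false)) (≤-reflexive (trans (sides true) n≡)))) }
          handshake′ : degreeSum id addEdge ≡ (Q * suc m + suc r) + (Q * suc m + suc r)
          handshake′ = trans handshake-addEdge (trans (cong (_+ 2) handshake)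
            (solve 2 (λ a r → a :+ r :+ (a :+ r) :+ con 2 := a :+ (con 1 :+ r) :+ (a :+ (con 1 :+ r))) refl (Q * suc m) r))
          fuel′ : suc n * suc n ≤ degreeSum id addEdge + k
          fuel′ = ≤-trans fuel (≤-trans (≤-reflexive (sym (+-assoc (degreeSum id B) 1 k)))
            (+-monoˡ-≤ k (≤-trans (+-monoʳ-≤ (degreeSum id B) (s≤s z≤n)) (≤-reflexive (sym handshake-addEdge)))))
          short′ : ∀ t → suc n ≡ suc (suc m) + t → t * suc (suc m) < Q * suc m + suc r
          short′ t eq = <-≤-trans (short t eq) (+-monoʳ-≤ (Q * suc m) (n≤1+n r))

        result : degreeSum G B ≤ f (suc m) Q r
        result with p <? r
        ... | yes p<r = low-degree p<r
        ... | no  p≮r = high-degree (≮⇒≥ p≮r)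

    bound : degreeSum G B ≤ f (suc m) Q r
    bound with <-cmp (suc n) (suc m + suc Q)
    ... | tri> _ _ gt = ⊥-elim (too-many-vertices gt)
    ... | tri< lt _ _ = few-vertices (s≤s⁻¹ (subst (suc n <_) (+-suc (suc m) Q) lt))
    ... | tri≈ _ eq _ with m≤n⇒m<n∨m≡n (Tight.Q≤m eq)
    ...   | inj₂ Q≡m = Tight.balanced eq Q≡m
    ...   | inj₁ Q<m with minimum (deg B)
    ...     | v , least = Tight.Unbalanced.result eq Q<m v least

  -- The recursion is lexicographic in n, k, m: deletion lowers n, a new edge lowers k, repacking
  -- lowers m. At k = 0 the bounds n² ≤ 2 e and 4 e ≤ n² contradict e ≥ 1.
  extremal : ∀ n k m → Bound n k m
  extremal zero _ m _ _ {Q} {r} handshake _ 1≤r _ _ _ =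
    contradiction (≤-trans 1≤r (≤-trans (m≤n+m r (Q * suc m)) (≤-trans (m≤m+n _ _) (≤-reflexive (sym handshake))))) λ ()
  extremal (suc n) zero m B (c , proper) {Q} {r} handshake fuel 1≤r _ _ _ =
    contradiction 4e≤2e (<⇒≱ 2e<4e)
    where
    e = Q * suc m + r
    4e≤2e : 4 * e ≤ e + e
    4e≤2e = ≤-trans (Coloured.4edges≤square B c proper {e} handshake)
      (≤-trans fuel (≤-reflexive (trans (+-identityʳ _) handshake)))
    2e<4e : e + e < 4 * e
    2e<4e = <-≤-trans (m<m+n (e + e) (≤-trans 1≤r (≤-trans (m≤n+m r _) (m≤m+n e e))))
      (≤-reflexive (solve 1 (λ e → e :+ e :+ (e :+ e) := con 4 :* e) refl e))
  extremal (suc n) (suc k) zero    = Step.bound (λ _ ()) (extremal (suc n) k zero) (extremal n)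
  extremal (suc n) (suc k) (suc m) = Step.bound
    (λ m′ eq → subst (Bound (suc n) (suc k)) (suc-injective eq) (extremal (suc n) (suc k) m))
    (extremal (suc n) k (suc m)) (extremal n)

-- Stars and degrees

count : ∀ {A : Set} → (A → Bool) → List A → ℕ
count P xs = length (filterᵇ P xs)

count-∷ : ∀ {A : Set} (P : A → Bool) x xs → count P (x ∷ xs) ≡ bit (P x) + count P xs
count-∷ P x xs with P x
... | true  = refl
... | false = refl

count-++ : ∀ {A : Set} (P : A → Bool) xs ys → count P (xs ++ ys) ≡ count P xs + count P ys
count-++ P []       ys = refl
count-++ P (x ∷ xs) ys = begin
  count P (x ∷ xs ++ ys)                  ≡⟨ count-∷ P x (xs ++ ys) ⟩
  bit (P x) + count P (xs ++ ys)          ≡⟨ cong (bit (P x) +_) (count-++ P xs ys) ⟩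
  bit (P x) + (count P xs + count P ys)   ≡⟨ +-assoc (bit (P x)) _ _ ⟨
  bit (P x) + count P xs + count P ys     ≡⟨ cong (_+ count P ys) (count-∷ P x xs) ⟨
  count P (x ∷ xs) + count P ys           ∎
  where open ≡-Reasoning

count-map : ∀ {A : Set} {B : Set} (P : A → Bool) (h : B → A) xs → count P (map h xs) ≡ count (P ∘ h) xs
count-map P h []       = refl
count-map P h (x ∷ xs) with P (h x)
... | true  = cong suc (count-map P h xs)
... | false = count-map P h xs

count-filter : ∀ {A : Set} (P R : A → Bool) xs → count P (filterᵇ R xs) ≡ count (λ x → R x ∧ P x) xs
count-filter P R []       = refl
count-filter P R (x ∷ xs) with R x
... | false = count-filter P R xs
... | true  with P x
...   | true  = cong suc (count-filter P R xs)
...   | false = count-filter P R xs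

count-none : ∀ {A : Set} (xs : List A) → count (λ _ → false) xs ≡ 0
count-none []       = refl
count-none (x ∷ xs) = count-none xs

count-tabulate : ∀ {n} {A : Set} (P : A → Bool) (h : Fin n → A) → count P (tabulate h) ≡ ∑[ i < n ] bit (P (h i))
count-tabulate {zero}  P h = refl
count-tabulate {suc n} P h = trans (count-∷ P (h zero) _) (cong (bit (P (h zero)) +_) (count-tabulate P (h ∘ suc)))

count-concat-tabulate : ∀ {n} {A : Set} (P : A → Bool) (h : Fin n → List A) →
                        count P (concat (tabulate h)) ≡ ∑[ i < n ] count P (h i)
count-concat-tabulate {zero}  P h = refl
count-concat-tabulate {suc n} P h = trans (count-++ P (h zero) _)
  (cong (count P (h zero) +_) (count-concat-tabulate P (h ∘ suc)))

count-combinations : ∀ {A : Set} (P : A → Bool) k xs → count (all P) (combinations k xs) ≡ count P xs C k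
count-combinations P zero    xs       = refl
count-combinations P (suc k) []       = sym (k>n⇒nCk≡0 (s≤s (z≤n {k})))
count-combinations P (suc k) (x ∷ xs) = begin
  count (all P) (map (x ∷_) (combinations k xs) ++ combinations (suc k) xs)
    ≡⟨ count-++ (all P) (map (x ∷_) (combinations k xs)) _ ⟩
  count (all P) (map (x ∷_) (combinations k xs)) + count (all P) (combinations (suc k) xs)
    ≡⟨ cong₂ _+_ (count-map (all P) (x ∷_) (combinations k xs)) (count-combinations P (suc k) xs) ⟩
  count (λ F → P x ∧ all P F) (combinations k xs) + count P xs C suc k
    ≡⟨ pascal ⟩
  count P (x ∷ xs) C suc k ∎
  where
  open ≡-Reasoning
  pascal : count (λ F → P x ∧ all P F) (combinations k xs) + count P xs C suc k ≡ count P (x ∷ xs) C suc k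
  pascal with P x
  ... | true  = trans (cong (_+ count P xs C suc k) (count-combinations P k xs)) (nCk+nC[k+1]≡[n+1]C[k+1] (count P xs) k)
  ... | false = cong (_+ count P xs C suc k) (count-none (combinations k xs))

combinations-All : ∀ {A : Set} {R : A → Set} k {xs} → All R xs → All (All R) (combinations k xs)
combinations-All zero    _        = [] ∷ []
combinations-All (suc k) []       = []
combinations-All (suc k) (r ∷ rs) =
  All.++⁺ (All.map⁺ (All.map (r ∷_) (combinations-All k rs))) (combinations-All (suc k) rs)

combinations-AllPairs : ∀ {A : Set} {R : A → A → Set} k {xs} → AllPairs R xs → All (AllPairs R) (combinations k xs)
combinations-AllPairs zero    _        = [] ∷ []
combinations-AllPairs (suc k) []       = []
combinations-AllPairs (suc k) (r ∷ rs) = All.++⁺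
  (All.map⁺ (All.zipWith (λ (a , b) → a ∷ b) (combinations-All k r , combinations-AllPairs k rs)))
  (combinations-AllPairs (suc k) rs)

combinations-length : ∀ {A : Set} k (xs : List A) → All (λ F → length F ≡ k) (combinations k xs)
combinations-length zero    xs       = refl ∷ []
combinations-length (suc k) []       = []
combinations-length (suc k) (x ∷ xs) =
  All.++⁺ (All.map⁺ (All.map (cong suc) (combinations-length k xs))) (combinations-length (suc k) xs)

count-allPairs : ∀ {n} (P : Fin n × Fin n → Bool) → count P (allPairs n) ≡ ∑[ i < n ] ∑[ j < n ] bit (P (i , j))
count-allPairs {n} P = begin
  count P (concat (map row (allFin n)))              ≡⟨ cong (count P ∘ concat) (List.map-tabulate id row) ⟩
  count P (concat (tabulate row))                    ≡⟨ count-concat-tabulate P row ⟩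
  ∑[ i < n ] count P (map (i ,_) (allFin n))
    ≡⟨ sum-cong-≗ (λ i → trans (count-map P (i ,_) (allFin n)) (count-tabulate (P ∘ (i ,_)) id)) ⟩
  ∑[ i < n ] ∑[ j < n ] bit (P (i , j))              ∎
  where
  open ≡-Reasoning
  row : Fin n → List (Fin n × Fin n)
  row i = map (i ,_) (allFin n)

bit-any-≤ : ∀ {A : Set} {n} (p : A → Bool) (h : Fin n → A) → bit (any p (tabulate h)) ≤ ∑[ i < n ] bit (p (h i))
bit-any-≤ {n = zero}  p h = z≤n
bit-any-≤ {n = suc n} p h with p (h zero)
... | true  = s≤s z≤n
... | false = bit-any-≤ p (h ∘ suc)

any-true : ∀ {A : Set} {n} (p : A → Bool) (h : Fin n → A) i → p (h i) ≡ true → any p (tabulate h) ≡ true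
any-true p h zero    eq rewrite eq = refl
any-true p h (suc i) eq rewrite any-true p (h ∘ suc) i eq = Bool.∨-zeroʳ (p (h zero))

sum≤bit-any : ∀ {n} (p : Fin n → Bool) → (∀ u v → p u ≡ true → p v ≡ true → u ≡ v) →
              ∑[ v < n ] bit (p v) ≤ bit (any p (allFin n))
sum≤bit-any {n} p unique with any p (allFin n) in eq
... | false = subst (_≤ 0) (sym (trans (sum-cong-≗ none) (trans (sum-const n 0) (*-zeroʳ n)))) z≤n
  where
  none : ∀ v → bit (p v) ≡ 0
  none v with p v in pv
  ... | false = refl
  ... | true  = contradiction (trans (sym (any-true p id v pv)) eq) λ ()
... | true  = ≮⇒≥ λ 2≤ → two 2≤
  where
  two : 1 < ∑[ v < n ] bit (p v) → ⊥
  two lt with sum-pos (bit ∘ p) (<⇒≤ lt)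
  ... | u , 1≤pu with p u in pu
  ...   | true = <⇒≱ lt (subst (∑[ v < n ] bit (p v) ≤_) (single-1 u) (sum-mono at-u))
    where
    at-u : ∀ v → bit (p v) ≤ bit ⌊ v ≟ᶠ u ⌋
    at-u v with p v in pv | v ≟ᶠ u
    ... | false | _     = z≤n
    ... | true  | yes _ = ≤-refl
    ... | true  | no ne = contradiction (unique v u pv pu) ne

≡ᵇ-toℕ : ∀ {n} (i v : Fin n) → (toℕ i ≡ᵇ toℕ v) ≡ ⌊ i ≟ᶠ v ⌋
≡ᵇ-toℕ i v with i ≟ᶠ v | toℕ i ≡ᵇ toℕ v in eq
... | yes _    | true  = refl
... | no _     | false = refl
... | yes refl | false = contradiction (≡⇒≡ᵇ (toℕ i) (toℕ i) refl) (subst (¬_ ∘ T) (sym eq) λ ())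
... | no ne    | true  = contradiction (toℕ-injective (≡ᵇ⇒≡ (toℕ i) (toℕ v) (subst T (sym eq) _))) ne

<ᵇ-true : ∀ {a b} → a < b → (a <ᵇ b) ≡ true
<ᵇ-true {a} {b} lt with a <ᵇ b | <⇒<ᵇ lt
... | true | _ = refl

<ᵇ-false : ∀ {a b} → b ≤ a → (a <ᵇ b) ≡ false
<ᵇ-false {a} {b} b≤a with a <ᵇ b in eq
... | false = refl
... | true  = contradiction (<ᵇ⇒< a b (subst T (sym eq) _)) (≤⇒≯ b≤a)

module Counting {n} (G : Graph n) where

  up : Fin n → Fin n → ℕ
  up i j = bit ((toℕ i <ᵇ toℕ j) ∧ adj G i j)

  up+up : ∀ i j → up i j + up j i ≡ bit (adj G i j)
  up+up i j with <-cmp (toℕ i) (toℕ j)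
  ... | tri< lt _ _ rewrite <ᵇ-true lt | <ᵇ-false (<⇒≤ lt) = +-identityʳ _
  ... | tri> _ _ gt rewrite <ᵇ-true gt | <ᵇ-false (<⇒≤ gt) | Graph.sym G j i = refl
  ... | tri≈ _ eq _ with toℕ-injective eq
  ...   | refl rewrite <ᵇ-false (≤-refl {toℕ i}) | irrefl G i = refl

  deg-up : ∀ v → deg G v ≡ ∑[ j < n ] up v j + ∑[ i < n ] up i v
  deg-up v = trans (sum-cong-≗ (λ j → sym (up+up v j))) (∑-distrib-+ (up v) (λ i → up i v))

  numEdges-up : numEdges G ≡ ∑[ i < n ] ∑[ j < n ] up i j
  numEdges-up = count-allPairs λ e → (toℕ (proj₁ e) <ᵇ toℕ (proj₂ e)) ∧ adj G (proj₁ e) (proj₂ e)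

  handshake : degreeSum id G ≡ numEdges G + numEdges G
  handshake = begin
    degreeSum id G                                             ≡⟨ sum-cong-≗ deg-up ⟩
    ∑[ v < n ] (∑[ j < n ] up v j + ∑[ i < n ] up i v)         ≡⟨ ∑-distrib-+ (λ v → ∑[ j < n ] up v j) _ ⟩
    ∑[ v < n ] ∑[ j < n ] up v j + ∑[ v < n ] ∑[ i < n ] up i v
      ≡⟨ cong (∑[ v < n ] ∑[ j < n ] up v j +_) (∑-comm (λ v i → up i v)) ⟩
    ∑[ v < n ] ∑[ j < n ] up v j + ∑[ i < n ] ∑[ v < n ] up i v ≡⟨ cong₂ _+_ numEdges-up numEdges-up ⟨
    numEdges G + numEdges G                                    ∎
    where open ≡-Reasoning

  incident-split : ∀ v i j → bit (((toℕ i <ᵇ toℕ j) ∧ adj G i j) ∧ incident v (i , j))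
                             ≡ bit ⌊ i ≟ᶠ v ⌋ * up i j + bit ⌊ j ≟ᶠ v ⌋ * up i j
  incident-split v i j rewrite ≡ᵇ-toℕ i v | ≡ᵇ-toℕ j v with i ≟ᶠ v | j ≟ᶠ v
  ... | yes refl | yes refl rewrite <ᵇ-false (≤-refl {toℕ i}) = refl
  ... | yes refl | no _     rewrite Bool.∧-identityʳ ((toℕ i <ᵇ toℕ j) ∧ adj G i j) =
    sym (trans (+-identityʳ _) (+-identityʳ _))
  ... | no _     | yes refl rewrite Bool.∧-identityʳ ((toℕ i <ᵇ toℕ j) ∧ adj G i j) = sym (+-identityʳ _)
  ... | no _     | no _     rewrite Bool.∧-zeroʳ ((toℕ i <ᵇ toℕ j) ∧ adj G i j) = refl

  count-incident : ∀ v → count (incident v) (edges G) ≡ deg G v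
  count-incident v = begin
    count (incident v) (edges G)
      ≡⟨ count-filter (incident v) _ (allPairs n) ⟩
    count _ (allPairs n)
      ≡⟨ count-allPairs (λ e → ((toℕ (proj₁ e) <ᵇ toℕ (proj₂ e)) ∧ adj G (proj₁ e) (proj₂ e)) ∧ incident v e) ⟩
    ∑[ i < n ] ∑[ j < n ] bit (((toℕ i <ᵇ toℕ j) ∧ adj G i j) ∧ incident v (i , j))
      ≡⟨ sum-cong-≗ (λ i → trans (sum-cong-≗ (incident-split v i)) (∑-distrib-+ (λ j → bit ⌊ i ≟ᶠ v ⌋ * up i j) _)) ⟩
    ∑[ i < n ] (∑[ j < n ] (bit ⌊ i ≟ᶠ v ⌋ * up i j) + ∑[ j < n ] (bit ⌊ j ≟ᶠ v ⌋ * up i j))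
      ≡⟨ sum-cong-≗ (λ i → cong₂ _+_ (sym (*-distribˡ-sum (bit ⌊ i ≟ᶠ v ⌋) (up i))) (single v (up i))) ⟩
    ∑[ i < n ] (bit ⌊ i ≟ᶠ v ⌋ * sum (up i) + up i v)
      ≡⟨ ∑-distrib-+ (λ i → bit ⌊ i ≟ᶠ v ⌋ * sum (up i)) _ ⟩
    ∑[ i < n ] (bit ⌊ i ≟ᶠ v ⌋ * sum (up i)) + ∑[ i < n ] up i v
      ≡⟨ cong (_+ ∑[ i < n ] up i v) (single v (λ i → sum (up i))) ⟩
    ∑[ j < n ] up v j + ∑[ i < n ] up i v
      ≡⟨ deg-up v ⟨
    deg G v ∎
    where open ≡-Reasoning

  stars-at : ∀ k v → count (all (incident v)) (combinations k (edges G)) ≡ deg G v C k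
  stars-at k v = trans (count-combinations (incident v) k (edges G)) (cong (_C k) (count-incident v))

  count-hasCommonVertex-≤ : ∀ Fs → count hasCommonVertex Fs ≤ ∑[ v < n ] count (all (incident v)) Fs
  count-hasCommonVertex-≤ []       = z≤n
  count-hasCommonVertex-≤ (F ∷ Fs) = begin
    count hasCommonVertex (F ∷ Fs)                                  ≡⟨ count-∷ hasCommonVertex F Fs ⟩
    bit (hasCommonVertex F) + count hasCommonVertex Fs
      ≤⟨ +-mono-≤ (bit-any-≤ (λ v → all (incident v) F) id) (count-hasCommonVertex-≤ Fs) ⟩
    ∑[ v < n ] bit (all (incident v) F) + ∑[ v < n ] count (all (incident v)) Fs
      ≡⟨ ∑-distrib-+ (λ v → bit (all (incident v) F)) _ ⟨
    ∑[ v < n ] (bit (all (incident v) F) + count (all (incident v)) Fs)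
      ≡⟨ sum-cong-≗ (λ v → count-∷ (all (incident v)) F Fs) ⟨
    ∑[ v < n ] count (all (incident v)) (F ∷ Fs) ∎
    where open ≤-Reasoning

  OneCentre : List (Fin n × Fin n) → Set
  OneCentre F = ∀ (u v : Fin n) → all (incident u) F ≡ true → all (incident v) F ≡ true → u ≡ v

  count-hasCommonVertex-≥ : ∀ {Fs} → All OneCentre Fs →
                            ∑[ v < n ] count (all (incident v)) Fs ≤ count hasCommonVertex Fs
  count-hasCommonVertex-≥ []       = ≤-reflexive (trans (sum-const n 0) (*-zeroʳ n))
  count-hasCommonVertex-≥ {F ∷ Fs} (one ∷ ones) = begin
    ∑[ v < n ] count (all (incident v)) (F ∷ Fs)
      ≡⟨ sum-cong-≗ (λ v → count-∷ (all (incident v)) F Fs) ⟩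
    ∑[ v < n ] (bit (all (incident v) F) + count (all (incident v)) Fs)
      ≡⟨ ∑-distrib-+ (λ v → bit (all (incident v) F)) _ ⟩
    ∑[ v < n ] bit (all (incident v) F) + ∑[ v < n ] count (all (incident v)) Fs
      ≤⟨ +-mono-≤ (sum≤bit-any (λ v → all (incident v) F) one) (count-hasCommonVertex-≥ ones) ⟩
    bit (hasCommonVertex F) + count hasCommonVertex Fs              ≡⟨ count-∷ hasCommonVertex F Fs ⟨
    count hasCommonVertex (F ∷ Fs)                                  ∎
    where open ≤-Reasoning

  numStars-≤ : ∀ k → numStars k G ≤ degreeSum (_C k) G
  numStars-≤ k = ≤-trans (count-hasCommonVertex-≤ (combinations k (edges G))) (≤-reflexive (sum-cong-≗ (stars-at k)))

  -- Uniqueness of the centre of a star with at least two edges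

  Ordered : Fin n × Fin n → Set
  Ordered (i , j) = toℕ i < toℕ j

  Meet : Fin n × Fin n → Fin n × Fin n → Set
  Meet e f = ∀ (u v : Fin n) → incident u e ≡ true → incident v e ≡ true →
             incident u f ≡ true → incident v f ≡ true → u ≡ v

  incident⇒ : ∀ (v i j : Fin n) → incident v (i , j) ≡ true → i ≡ v ⊎ j ≡ v
  incident⇒ v i j inc rewrite ≡ᵇ-toℕ i v | ≡ᵇ-toℕ j v with i ≟ᶠ v | j ≟ᶠ v
  ... | yes eq | _      = inj₁ eq
  ... | no _   | yes eq = inj₂ eq

  -- If u and v differed, both edges would consist of u and v; listing the smaller end first would
  -- then make them equal as pairs.
  distinct⇒meet : ∀ {e f} → Ordered e → Ordered f → e ≢ f → Meet e f
  distinct⇒meet {a , b} {x , y} a<b x<y e≢f u v ue ve uf vf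
    with incident⇒ u a b ue | incident⇒ v a b ve | incident⇒ u x y uf | incident⇒ v x y vf
  ... | inj₁ refl | inj₁ refl | _ | _ = refl
  ... | inj₂ refl | inj₂ refl | _ | _ = refl
  ... | _ | _ | inj₁ refl | inj₁ refl = refl
  ... | _ | _ | inj₂ refl | inj₂ refl = refl
  ... | inj₁ refl | inj₂ refl | inj₁ refl | inj₂ refl = contradiction refl e≢f
  ... | inj₂ refl | inj₁ refl | inj₂ refl | inj₁ refl = contradiction refl e≢f
  ... | inj₁ refl | inj₂ refl | inj₂ refl | inj₁ refl = contradiction a<b (<-asym x<y)
  ... | inj₂ refl | inj₁ refl | inj₁ refl | inj₂ refl = contradiction a<b (<-asym x<y)

  allPairs-unique : Unique (allPairs n)
  allPairs-unique = subst Unique (sym (product (allFin n) (allFin n)))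
    (Unique.cartesianProduct⁺ (Unique.allFin⁺ n) (Unique.allFin⁺ n))
    where
    product : ∀ (xs ys : List (Fin n)) → concatMap (λ i → map (λ j → (i , j)) ys) xs ≡ cartesianProduct xs ys
    product []       ys = refl
    product (x ∷ xs) ys = cong (map (x ,_) ys ++_) (product xs ys)

  edges-ordered : All Ordered (edges G)
  edges-ordered = All.map (λ {e} → ordered e) (All.all-filter _ (allPairs n))
    where
    ordered : ∀ e → T ((toℕ (proj₁ e) <ᵇ toℕ (proj₂ e)) ∧ adj G (proj₁ e) (proj₂ e)) → Ordered e
    ordered (i , j) h with toℕ i <ᵇ toℕ j in eq
    ... | true = <ᵇ⇒< (toℕ i) (toℕ j) (subst T (sym eq) _)

  edges-meet : AllPairs Meet (edges G)
  edges-meet = go edges-ordered (Unique.filter⁺ _ allPairs-unique)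
    where
    go : ∀ {es} → All Ordered es → Unique es → AllPairs Meet es
    go []       []       = []
    go (o ∷ os) (d ∷ ds) = All.zipWith (λ (o′ , e≢f) → distinct⇒meet o o′ e≢f) (os , d) ∷ go os ds

  one-centre : ∀ k → All OneCentre (combinations (2 + k) (edges G))
  one-centre k = All.zipWith (λ {F} → centre {F})
    (combinations-AllPairs (2 + k) edges-meet , combinations-length (2 + k) (edges G))
    where
    centre : ∀ {F} → AllPairs Meet F × length F ≡ 2 + k → OneCentre F
    centre {e ∷ f ∷ F} (((meet ∷ _) ∷ _) , _) u v uF vF =
      meet u v (Bool.∧-conicalˡ (incident u e) _ uF) (Bool.∧-conicalˡ (incident v e) _ vF)
        (Bool.∧-conicalˡ (incident u f) _ (Bool.∧-conicalʳ (incident u e) _ uF))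
        (Bool.∧-conicalˡ (incident v f) _ (Bool.∧-conicalʳ (incident v e) _ vF))

  -- Two distinct edges determine the centre, so the sum over centres counts no star twice. A single
  -- edge has both ends as centres, so k = 1 is treated apart.
  numStars-≥ : ∀ k → degreeSum (_C (2 + k)) G ≤ numStars (2 + k) G
  numStars-≥ k = ≤-trans (≤-reflexive (sum-cong-≗ (λ v → sym (stars-at (2 + k) v))))
    (count-hasCommonVertex-≥ (one-centre k))

  numStars-1 : numStars 1 G ≡ numEdges G
  numStars-1 = go (edges G)
    where
    centre : ∀ (i j : Fin n) → all (incident i) ((i , j) ∷ []) ≡ true
    centre i j rewrite ≡ᵇ-toℕ i i with i ≟ᶠ i
    ... | yes _ = refl
    ... | no ne = contradiction refl ne
    go : ∀ es → count (hasCommonVertex {n}) (combinations 1 es) ≡ length es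
    go []             = refl
    go ((i , j) ∷ es) rewrite any-true (λ v → all (incident v) ((i , j) ∷ [])) id i (centre i j) = cong suc (go es)

-- The quasi-complete bipartite graph

C-step : ∀ x j → x C j ≤ suc x C j
C-step x zero    = ≤-refl
C-step x (suc j) = ≤-trans (m≤n+m _ (x C j)) (≤-reflexive (nCk+nC[k+1]≡[n+1]C[k+1] x j))

-- By Pascal's rule the increments of C(x, j + 2) are C(x, j + 1), whose own increments C(x, j) do
-- not decrease in x.
binomial : ∀ j → ConvexPrimitive (_C (2 + j)) (_C (1 + j))
binomial j = record
  { G-zero = k>n⇒nCk≡0 {0} {2 + j} (s≤s z≤n)
  ; G-suc  = λ x → trans (sym (nCk+nC[k+1]≡[n+1]C[k+1] x (suc j))) (+-comm (x C suc j) _)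
  ; g-step = λ x → C-step x (suc j)
  ; convex = λ x → begin
      suc x C suc j + suc x C suc j            ≡⟨ cong (_+ suc x C suc j) (nCk+nC[k+1]≡[n+1]C[k+1] x j) ⟨
      x C j + x C suc j + suc x C suc j        ≤⟨ +-monoˡ-≤ _ (+-monoˡ-≤ _ (C-step x j)) ⟩
      suc x C j + x C suc j + suc x C suc j
        ≡⟨ solve 3 (λ a b c → a :+ b :+ c := b :+ (a :+ c)) refl (suc x C j) (x C suc j) (suc x C suc j) ⟩
      x C suc j + (suc x C j + suc x C suc j)  ≡⟨ cong (x C suc j +_) (nCk+nC[k+1]≡[n+1]C[k+1] (suc x) j) ⟩
      x C suc j + (2 + x) C suc j              ∎
  }
  where open ≤-Reasoning

-- The local function go of tParam cannot be named; the metavariable search is solved by it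
-- once its four arguments are distinct variables.
mutual
  search : (n e f i : ℕ) → ℕ
  search = _

  search-is-go : ∀ m e → tParam (suc m) e ≡ (if e ≤ᵇ m + 0 then 1 else search (suc m) e m 2)
  search-is-go m e with suc m | 2
  ... | n | i = refl

-- An admissible h within reach of the fuel guarantees success. The invariant on q records that the
-- preceding candidate fails, and becomes the minimality of the result.
search-spec : ∀ {n e h} → e ≤ h * (n ∸ h) → ∀ f q → suc q ≤ h → h ≤ suc q + f → q * (n ∸ q) < e →
              ∃ λ Q → search n e f (suc q) ≡ suc Q × suc Q ≤ h × Q * (n ∸ Q) < e × e ≤ suc Q * (n ∸ suc Q)
-- Out of fuel, the default answer q + 1 is h itself, hence admissible.
search-spec e≤ zero q q<h h≤q below rewrite +-identityʳ q with ≤-antisym q<h h≤q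
... | refl = q , refl , ≤-refl , below , e≤
search-spec {n} {e} e≤ (suc f) q q<h h≤ below with e ≤ᵇ suc q * (n ∸ suc q) in eq
... | true  = q , refl , q<h , below , ≤ᵇ⇒≤ e _ (subst T (sym eq) _)
... | false = search-spec e≤ f (suc q) (≤∧≢⇒< q<h λ { refl → above e≤ })
                (≤-trans h≤ (≤-reflexive (+-suc (suc q) f))) (≰⇒> above)
  where
  above : ¬ (e ≤ suc q * (n ∸ suc q))
  above le = subst T eq (≤⇒≤ᵇ le)

halves : ∀ n → ⌈ n /2⌉ ≡ ⌊ n /2⌋ ⊎ ⌈ n /2⌉ ≡ suc ⌊ n /2⌋
halves 0             = inj₁ refl
halves 1             = inj₂ refl
halves (suc (suc n)) with halves n
... | inj₁ eq = inj₁ (cong suc eq)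
... | inj₂ eq = inj₂ (cong suc eq)

quarter-square : ∀ {n e} → 4 * e ≤ n * n → e ≤ ⌊ n /2⌋ * ⌈ n /2⌉
quarter-square {n} {e} 4e≤n² with ⌊ n /2⌋ | ⌈ n /2⌉ | ⌊n/2⌋+⌈n/2⌉≡n n | halves n
... | a | _ | refl | inj₁ refl = *-cancelˡ-≤ 4 (≤-trans 4e≤n² (≤-reflexive (even a)))
  where
  even : ∀ a → (a + a) * (a + a) ≡ 4 * (a * a)
  even = solve 1 (λ a → (a :+ a) :* (a :+ a) := con 4 :* (a :* a)) refl
... | a | _ | refl | inj₂ refl = s≤s⁻¹ (*-cancelˡ-< 4 e _ (≤-<-trans 4e≤n²
    (≤-trans (m≤m+n _ 2) (≤-reflexive (odd a)))))
  where
  odd : ∀ a → suc ((a + suc a) * (a + suc a)) + 2 ≡ 4 * suc (a * suc a)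
  odd = solve 1 (λ a → con 1 :+ (a :+ (con 1 :+ a)) :* (a :+ (con 1 :+ a)) :+ con 2
                       := con 4 :* (con 1 :+ a :* (con 1 :+ a))) refl

-- The larger part has M = r + d vertices, d of which are missed by vertex 0. `Q<r` is the
-- minimality of t = Q + 1: it restates Q (n - Q) < e.
record Parameters (n e : ℕ) : Set where
  field
    Q r d   : ℕ
    t≡      : tParam n e ≡ suc Q
    n≡      : n ≡ suc Q + (r + d)
    e≡      : e ≡ Q * (r + d) + r
    Q<r     : Q < r

parameters : ∀ {n e} → 1 ≤ e → 4 * e ≤ n * n → Parameters n e
parameters {n} {e} 1≤e 4e≤n² with search-spec {n} {e} {⌊ n /2⌋} e≤half n 0 1≤half
    (≤-trans (⌊n/2⌋≤n n) (n≤1+n n)) 1≤e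
  where
  e≤half : e ≤ ⌊ n /2⌋ * (n ∸ ⌊ n /2⌋)
  e≤half = subst (λ x → e ≤ ⌊ n /2⌋ * x)
    (trans (sym (m+n∸m≡n ⌊ n /2⌋ ⌈ n /2⌉)) (cong (_∸ ⌊ n /2⌋) (⌊n/2⌋+⌈n/2⌉≡n n))) (quarter-square {n} 4e≤n²)
  1≤half : 1 ≤ ⌊ n /2⌋
  1≤half with ⌊ n /2⌋ | e≤half
  ... | suc _ | _  = s≤s z≤n
  ... | zero  | e≤0 = ≤-trans 1≤e e≤0
... | Q , t≡ , Q<half , below , above
  with m≤n⇒∃[o]m+o≡n (≤-trans Q<half (⌊n/2⌋≤n n))
...   | M , refl
  with m≤n⇒∃[o]m+o≡n (≤-trans (*-monoʳ-≤ Q (n≤1+n M)) (<⇒≤ below′))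
  where
  below′ : Q * suc M < e
  below′ = subst (λ x → Q * x < e) (trans (cong (_∸ Q) (sym (+-suc Q M))) (m+n∸m≡n Q (suc M))) below
...     | r , refl
  with m≤n⇒∃[o]m+o≡n (+-cancelˡ-≤ (Q * M) r M (≤-trans (subst (λ x → Q * M + r ≤ suc Q * x) (m+n∸m≡n Q M) above)
                        (≤-reflexive (+-comm M (Q * M)))))
...       | d , refl = record
  { Q = Q ; r = r ; d = d ; t≡ = t≡ ; n≡ = refl ; e≡ = refl
  ; Q<r = +-cancelˡ-< (Q * (r + d)) Q r (subst (_< Q * (r + d) + r)
      (trans (*-suc Q (r + d)) (+-comm Q _)) (subst (λ x → Q * x < Q * (r + d) + r)
        (trans (cong (_∸ Q) (sym (+-suc Q (r + d)))) (m+n∸m≡n Q (suc (r + d)))) below)) }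

-- Degrees in the quasi-complete graph

sum-split : ∀ a b (h : ℕ → ℕ) → ∑[ i < a + b ] h (toℕ i) ≡ ∑[ i < a ] h (toℕ i) + ∑[ i < b ] h (a + toℕ i)
sum-split zero    b h = refl
sum-split (suc a) b h = trans (cong (h 0 +_) (sum-split a b (h ∘ suc))) (sym (+-assoc (h 0) _ _))

sum-block : ∀ a (h : ℕ → ℕ) {c} → (∀ i → i < a → h i ≡ c) → ∑[ i < a ] h (toℕ i) ≡ a * c
sum-block zero    h _  = refl
sum-block (suc a) h h≡ = cong₂ _+_ (h≡ 0 (s≤s z≤n)) (sum-block a (h ∘ suc) (λ i i<a → h≡ (suc i) (s≤s i<a)))

module Quasi {n e} (ps : Parameters n e) where
  open Parameters ps

  Flags : Set
  Flags = Bool × Bool × Bool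

  -- Is the vertex in the part of size t, is it vertex 0, does it precede the last d vertices?
  flags : ℕ → Flags
  flags a = (a <ᵇ suc Q) , (a ≡ᵇ 0) , (a <ᵇ suc Q + r)

  -- The only four triples that occur: vertex 0, the other Q vertices of its part, its r neighbours,
  -- and the d vertices it misses. Adjacency depends on these classes alone.
  apex full near far : Flags
  apex = true , true , true
  full = true , false , true
  near = false , false , true
  far  = false , false , false

  cross : Flags → Flags → Bool
  cross (low , first , _) (low′ , _ , kept′) = low ∧ (not low′ ∧ (not first ∨ kept′))

  -- The number t (n - t) - e of deleted edges is d, which places the cut-off n - d at Q + 1 + r.
  quasiCross≡ : ∀ a b → quasiCross n e a b ≡ cross (flags a) (flags b)
  quasiCross≡ a b rewrite t≡ = cong (λ x → (a <ᵇ suc Q) ∧ (not (b <ᵇ suc Q) ∧ (not (a ≡ᵇ 0) ∨ (b <ᵇ x)))) kept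
    where
    M≡ : n ∸ suc Q ≡ r + d
    M≡ = trans (cong (_∸ suc Q) n≡) (m+n∸m≡n (suc Q) (r + d))
    missing : suc Q * (n ∸ suc Q) ∸ e ≡ d
    missing rewrite M≡ = trans (cong (suc Q * (r + d) ∸_) e≡)
      (trans (cong (_∸ (Q * (r + d) + r)) (rearrange Q r d)) (m+n∸m≡n (Q * (r + d) + r) d))
      where
      rearrange : ∀ Q r d → suc Q * (r + d) ≡ Q * (r + d) + r + d
      rearrange = solve 3 (λ Q r d → (con 1 :+ Q) :* (r :+ d) := Q :* (r :+ d) :+ r :+ d) refl
    kept : n ∸ (suc Q * (n ∸ suc Q) ∸ e) ≡ suc Q + r
    kept rewrite missing = trans (cong (_∸ d) (trans n≡ (sym (+-assoc (suc Q) r d)))) (m+n∸n≡m (suc Q + r) d)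

  sum-flags : ∀ (h : Flags → ℕ) → ∑[ i < n ] h (flags (toℕ i)) ≡ h apex + (Q * h full + (r * h near + d * h far))
  sum-flags h = begin
    ∑[ i < n ] h (flags (toℕ i))
      ≡⟨ cong (λ n → ∑[ i < n ] h (flags (toℕ i))) n≡ ⟩
    h apex + ∑[ i < Q + (r + d) ] H (suc (toℕ i))
      ≡⟨ cong (h apex +_) (sum-split Q (r + d) (H ∘ suc)) ⟩
    h apex + (∑[ i < Q ] H (suc (toℕ i)) + ∑[ i < r + d ] H (suc Q + toℕ i))
      ≡⟨ cong (λ x → h apex + (∑[ i < Q ] H (suc (toℕ i)) + x)) (sum-split r d (λ i → H (suc Q + i))) ⟩
    h apex + (∑[ i < Q ] H (suc (toℕ i)) + (∑[ i < r ] H (suc Q + toℕ i) + ∑[ i < d ] H (suc Q + (r + toℕ i))))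
      ≡⟨ cong (h apex +_) (cong₂ _+_ (sum-block Q (H ∘ suc) in-full)
           (cong₂ _+_ (sum-block r (λ i → H (suc Q + i)) in-near) (sum-block d (λ i → H (suc Q + (r + i))) in-far))) ⟩
    h apex + (Q * h full + (r * h near + d * h far)) ∎
    where
    open ≡-Reasoning
    H : ℕ → ℕ
    H a = h (flags a)
    flags≡ : ∀ a {l z k} → (a <ᵇ suc Q) ≡ l → (a ≡ᵇ 0) ≡ z → (a <ᵇ suc Q + r) ≡ k → H a ≡ h (l , z , k)
    flags≡ _ refl refl refl = refl
    in-full : ∀ i → i < Q → H (suc i) ≡ h full
    in-full i i<Q = flags≡ (suc i) (<ᵇ-true (s≤s i<Q)) refl (<ᵇ-true (s≤s (≤-trans i<Q (m≤m+n Q r))))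
    in-near : ∀ i → i < r → H (suc Q + i) ≡ h near
    in-near i i<r = flags≡ (suc Q + i) (<ᵇ-false (m≤m+n (suc Q) i)) refl (<ᵇ-true (+-monoʳ-< (suc Q) i<r))
    in-far : ∀ i → i < d → H (suc Q + (r + i)) ≡ h far
    in-far i _ = flags≡ (suc Q + (r + i)) (<ᵇ-false (m≤m+n (suc Q) (r + i))) refl
      (<ᵇ-false (+-monoʳ-≤ (suc Q) (m≤m+n r i)))

  degree : Flags → ℕ
  degree x = link apex + (Q * link full + (r * link near + d * link far))
    where
    link : Flags → ℕ
    link y = bit (cross x y ∨ cross y x)

  deg-quasi : ∀ v → deg (quasiComplete n e) v ≡ degree (flags (toℕ v))
  deg-quasi v = trans
    (sum-cong-≗ {n} (λ w → cong bit (cong₂ _∨_ (quasiCross≡ (toℕ v) (toℕ w)) (quasiCross≡ (toℕ w) (toℕ v)))))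
    (sum-flags (λ y → bit (cross (flags (toℕ v)) y ∨ cross y (flags (toℕ v)))))

  degreeSum-quasi : ∀ Φ → degreeSum Φ (quasiComplete n e) ≡ Φ r + (Q * Φ (r + d) + (r * Φ (suc Q) + d * Φ Q))
  degreeSum-quasi Φ = trans (sum-cong-≗ {n} (λ v → cong Φ (deg-quasi v))) (trans (sum-flags (Φ ∘ degree))
    (cong₂ _+_ (cong Φ (at-apex Q r d)) (cong₂ _+_ (cong (λ x → Q * Φ x) (at-full Q r d))
      (cong₂ _+_ (cong (λ x → r * Φ x) (at-near Q r d)) (cong (λ x → d * Φ x) (at-far Q r d))))))
    where
    at-apex : ∀ Q r d → Q * 0 + (r * 1 + d * 0) ≡ r
    at-apex = solve 3 (λ Q r d → Q :* con 0 :+ (r :* con 1 :+ d :* con 0) := r) refl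
    at-full : ∀ Q r d → Q * 0 + (r * 1 + d * 1) ≡ r + d
    at-full = solve 3 (λ Q r d → Q :* con 0 :+ (r :* con 1 :+ d :* con 1) := r :+ d) refl
    at-near : ∀ Q r d → 1 + (Q * 1 + (r * 0 + d * 0)) ≡ suc Q
    at-near = solve 3 (λ Q r d → con 1 :+ (Q :* con 1 :+ (r :* con 0 :+ d :* con 0)) := con 1 :+ Q) refl
    at-far : ∀ Q r d → Q * 1 + (r * 0 + d * 0) ≡ Q
    at-far = solve 3 (λ Q r d → Q :* con 1 :+ (r :* con 0 :+ d :* con 0) := Q) refl

  numEdges-quasi : numEdges (quasiComplete n e) ≡ e
  numEdges-quasi = double-injective (trans (sym (Counting.handshake (quasiComplete n e)))
    (trans (degreeSum-quasi id) (trans (total Q r d) (sym (cong₂ _+_ e≡ e≡)))))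
    where
    total : ∀ Q r d → r + (Q * (r + d) + (r * suc Q + d * Q)) ≡ Q * (r + d) + r + (Q * (r + d) + r)
    total = solve 3 (λ Q r d → r :+ (Q :* (r :+ d) :+ (r :* (con 1 :+ Q) :+ d :* Q))
                      := Q :* (r :+ d) :+ r :+ (Q :* (r :+ d) :+ r)) refl

  bipartite-quasi : IsBipartite (quasiComplete n e)
  bipartite-quasi = (λ i → toℕ i <ᵇ tParam n e) , λ i j → proper _ _ _ _
    where
    proper : ∀ l l′ x y → ((l ∧ (not l′ ∧ x)) ∨ (l′ ∧ (not l ∧ y))) ≡ true → l ≢ l′
    proper true  true  _ _ () refl
    proper false false _ _ () refl

  degreeSum≤quasi : ∀ j (B : Graph n) → IsBipartite B → numEdges B ≡ e →
                    degreeSum (_C (2 + j)) B ≤ degreeSum (_C (2 + j)) (quasiComplete n e)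
  degreeSum≤quasi j B bip edges≡ with r + d in M≡
  ... | zero  = contradiction (≤-trans Q<r (≤-trans (m≤m+n r d) (≤-reflexive M≡))) λ ()
  ... | suc m = ≤-trans
    (Extremal.extremal (binomial j) n (n * n) m B bip {Q} {r}
      (trans (Counting.handshake B) (cong₂ _+_ (trans edges≡ e≡′) (trans edges≡ e≡′)))
      (m≤n+m _ _) (≤-trans (s≤s z≤n) Q<r) r≤M
      (≤-trans (≤-reflexive n≡′) (+-monoˡ-≤ (suc m) (≤-trans Q<r r≤M)))
      short)
    (≤-reflexive (trans quasi (sym (trans (degreeSum-quasi (_C (2 + j)))
      (cong (λ M → r C (2 + j) + (Q * (M C (2 + j)) + (r * (suc Q C (2 + j)) + d * (Q C (2 + j))))) M≡)))))
    where
    open ConvexPrimitive (binomial j)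
    r≤M : r ≤ suc m
    r≤M = ≤-trans (m≤m+n r d) (≤-reflexive M≡)
    n≡′ : n ≡ suc Q + suc m
    n≡′ = trans n≡ (cong (suc Q +_) M≡)
    e≡′ : e ≡ Q * suc m + r
    e≡′ = trans e≡ (cong (λ M → Q * M + r) M≡)
    -- Again t = Q, and Q (M + 1) < e is the minimality of the smaller part, in the form Q < r.
    short : ∀ t → n ≡ suc (suc m) + t → t * suc (suc m) < Q * suc m + r
    short t eq with +-cancelˡ-≡ (suc (suc m)) t Q (trans (sym eq)
      (trans n≡′ (trans (+-comm (suc Q) (suc m)) (+-suc (suc m) Q))))
    ... | refl = ≤-trans (≤-reflexive (cong suc (trans (*-suc Q (suc m)) (+-comm Q _)))) (+-monoʳ-< (Q * suc m) Q<r)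
    quasi : quasiSum (_C (2 + j)) (_C (1 + j)) (suc m) Q r
            ≡ r C (2 + j) + (Q * (suc m C (2 + j)) + (r * (suc Q C (2 + j)) + d * (Q C (2 + j))))
    quasi rewrite G-suc Q = trans
      (cong (λ M → Q * (suc m C (2 + j)) + M * (Q C (2 + j)) + r * (Q C (1 + j)) + r C (2 + j)) (sym M≡))
      (solve 7 (λ Q r d GM GQ gQ Gr → Q :* GM :+ (r :+ d) :* GQ :+ r :* gQ :+ Gr
                  := Gr :+ (Q :* GM :+ (r :* (GQ :+ gQ) :+ d :* GQ))) refl
        Q r d (suc m C (2 + j)) (Q C (2 + j)) (Q C (1 + j)) (r C (2 + j)))

theorem1p3 : (k n e : ℕ) → 1 ≤ k → 1 ≤ n → 1 ≤ e → 4 * e ≤ n * n →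
    (IsBipartite (quasiComplete n e) × numEdges (quasiComplete n e) ≡ e)
    × ((B : Graph n) → IsBipartite B → numEdges B ≡ e →
    numStars k B ≤ numStars k (quasiComplete n e))
theorem1p3 k n e 1≤k _ 1≤e 4e≤n² = (bipartite-quasi , numEdges-quasi) , stars k 1≤k
  where
  open Quasi (parameters {n} {e} 1≤e 4e≤n²)
  stars : ∀ k → 1 ≤ k → (B : Graph n) → IsBipartite B → numEdges B ≡ e →
          numStars k B ≤ numStars k (quasiComplete n e)
  stars 1 _ B _ edges≡ = ≤-reflexive (trans (Counting.numStars-1 B)
    (trans edges≡ (sym (trans (Counting.numStars-1 (quasiComplete n e)) numEdges-quasi))))
  stars (suc (suc j)) _ B bip edges≡ = ≤-trans (Counting.numStars-≤ B (2 + j))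
    (≤-trans (degreeSum≤quasi j B bip edges≡) (Counting.numStars-≥ (quasiComplete n e) j))
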